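{- Let $M=(E,I)$ be a matroid on $m$ elements that is representable over $\mathbb{F}_2$ and satisfies a smooth circuit counting bound. Then there is a randomized algorithm using $O(\log m)$ adaptive rounds and $\mathrm{poly}(m)$ independence-oracle queries per round which finds a basis of $M$ with high probability.
   Context: A matroid $M=(E,I)$ is representable over $\mathbb{F}_2$ (binary) if there are vectors $v_e$ over $\mathbb{F}_2$, $e\in E$, such that $S\subseteq E$ is independent iff $\{v_e:e\in S\}$ is linearly independent over $\mathbb{F}_2$. A circuit is a minimal dependent set; its length is its cardinality. For $S\subseteq E$, $M|_S=(S,I\cap 2^S)$. $M$ satisfies a smooth circuit counting bound if there is a constant $K$ such that for every $S\subseteq E$, if $M|_S$ has minimum circuit length $\ell$, then for every positive integer $\alpha$ the number of circuits of length at most $\alpha\ell$ in $M|_S$ is at most $m^{K\alpha}$. The algorithm accesses $M$ only via an independence oracle that answers, for $S\subseteq E$, whether $S\in I$; in each adaptive round it submits a batch of queries depending on answers from earlier rounds. A basis is a maximal independent set. -}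

module Defs where

open import Data.Nat using (ℕ; zero; suc; _+_; _*_; _^_; _≤_; _<_)
open import Data.Nat.Logarithm using (⌊log₂_⌋)
open import Data.Bool using (Bool; true; false; _xor_)
open import Data.Fin using (Fin; zero; suc)
open import Data.Fin.Subset using (Subset; _∈_; _∉_; _⊆_; _⊂_; ∣_∣; ⁅_⁆; _∪_; Nonempty) renaming (⊥ to ∅)
open import Data.Vec using (Vec; []; _∷_; replicate; zipWith)
open import Data.List using (List; length)
open import Data.List.Membership.Propositional using () renaming (_∈_ to _∈ˡ_)
open import Data.List.Relation.Unary.Unique.Propositional using (Unique)
open import Data.Product using (Σ; ∃; _×_; _,_)
open import Relation.Binary.PropositionalEquality using (_≡_; _≢_)
open import Relation.Nullary using (¬_)

-- A matroid on the ground set E = Fin m, given by its (Boolean-valued)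
-- independence predicate, i.e. exactly the independence oracle.
record Matroid (m : ℕ) : Set where
  field
    indep      : Subset m → Bool
    indep-∅    : indep ∅ ≡ true
    indep-down : ∀ {A B} → B ⊆ A → indep A ≡ true → indep B ≡ true
    indep-exch : ∀ {A B} → indep A ≡ true → indep B ≡ true → ∣ A ∣ < ∣ B ∣ →
                 ∃ λ x → x ∈ B × x ∉ A × indep (A ∪ ⁅ x ⁆) ≡ true
open Matroid public

zeroVec : ∀ {d} → Vec Bool d
zeroVec = replicate _ false

_⊕_ : ∀ {d} → Vec Bool d → Vec Bool d → Vec Bool d
_⊕_ = zipWith _xor_

sumF2 : ∀ {m d} → (Fin m → Vec Bool d) → Subset m → Vec Bool d
sumF2 {zero}  v []          = zeroVec
sumF2 {suc m} v (true  ∷ T) = v zero ⊕ sumF2 (λ i → v (suc i)) T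
sumF2 {suc m} v (false ∷ T) = sumF2 (λ i → v (suc i)) T

-- {v e : e ∈ S} is linearly independent over F₂: no nontrivial F₂-linear
-- combination (i.e. no sum over a nonempty subset T ⊆ S) vanishes.
LinIndepF2 : ∀ {m d} → (Fin m → Vec Bool d) → Subset m → Set
LinIndepF2 v S = ∀ T → T ⊆ S → Nonempty T → sumF2 v T ≢ zeroVec

Binary : ∀ {m} → Matroid m → Set
Binary {m} M = ∃ λ d → Σ (Fin m → Vec Bool d) λ v →
  ∀ S → (indep M S ≡ true → LinIndepF2 v S) × (LinIndepF2 v S → indep M S ≡ true)

IsCircuit : ∀ {m} → Matroid m → Subset m → Set
IsCircuit M C = indep M C ≡ false × (∀ T → T ⊂ C → indep M T ≡ true)

-- Circuits of M|_S are exactly the circuits of M contained in S.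
IsCircuitIn : ∀ {m} → Matroid m → Subset m → Subset m → Set
IsCircuitIn M S C = C ⊆ S × IsCircuit M C

MinCircuitLength : ∀ {m} → Matroid m → Subset m → ℕ → Set
MinCircuitLength M S ℓ =
  (∃ λ C → IsCircuitIn M S C × ∣ C ∣ ≡ ℓ) ×
  (∀ C → IsCircuitIn M S C → ℓ ≤ ∣ C ∣)

-- Smooth circuit counting bound with constant K: the number of circuits of
-- M|_S of length ≤ αℓ is ≤ m^(Kα), stated as: every duplicate-free list of
-- such circuits has length ≤ m^(Kα).
SmoothCircuitBound : ∀ {m} → Matroid m → ℕ → Set
SmoothCircuitBound {m} M K =
  ∀ S ℓ → MinCircuitLength M S ℓ → ∀ α → 1 ≤ α →
  ∀ (Cs : List (Subset m)) → Unique Cs →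
  (∀ {C} → C ∈ˡ Cs → IsCircuitIn M S C × ∣ C ∣ ≤ α * ℓ) →
  length Cs ≤ m ^ (K * α)

IsBasis : ∀ {m} → Matroid m → Subset m → Set
IsBasis M B = indep M B ≡ true × (∀ A → B ⊂ A → indep M A ≡ false)

data Strategy (m q : ℕ) : ℕ → Set where
  done : Subset m → Strategy m q zero
  ask  : ∀ {R} → (Fin q → Subset m) → ((Fin q → Bool) → Strategy m q R) →
         Strategy m q (suc R)

run : ∀ {m q R} → (Subset m → Bool) → Strategy m q R → Subset m
run O (done B)  = B
run O (ask Q k) = run O (k (λ j → O (Q j)))

RandAlg : ℕ → ℕ → ℕ → ℕ → Set
RandAlg m q R r = Vec Bool r → Strategy m q R

-- Success with high probability: Pr[output is not a basis] ≤ 1/m, stated as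
-- every duplicate-free list of failing random strings has length * m ≤ 2^r.
FindsBasisWHP : ∀ {m q R r} → RandAlg m q R r → Matroid m → Set
FindsBasisWHP {m} {r = r} A M =
  ∀ (ρs : List (Vec Bool r)) → Unique ρs →
  (∀ {ρ} → ρ ∈ˡ ρs → ¬ IsBasis M (run (indep M) (A ρ))) →
  length ρs * m ≤ 2 ^ r

{-# OPTIONS --safe #-}
module Submission where

-- Independence in M means that no nonempty set of elements sums to zero, so M is governed by its cycle space,
-- which is closed under symmetric difference. Let ℓ be the shortest circuit length in the current set S, and let C
-- be a cycle in S of length at most 3ℓ/2. Any other circuit C′ in S satisfies ∣C ⊕ C′∣ ≥ ℓ, hence has at least a
-- quarter of its elements outside C. If every element is sampled with probability p, where p ^ ℓ is a small power
-- of 1/m, then the counting bound and a union bound over the circuits C′ show that, given that the sample contains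
-- C, with probability at least 1/2 it contains no other circuit. So polynomially many samples isolate every such C,
-- for all S at once, with high probability. A unique cycle is recognised by deleting single elements from the
-- sample, all in one round. Removing the greatest element of each unique cycle found preserves the span of S and
-- destroys all cycles of length at most 3ℓ/2, so ℓ grows by a factor 3/2 per round, until S is a basis.

open import Defs
open import Data.Bool using (Bool; true; false; _xor_)
open import Data.Bool.Properties using (xor-assoc; xor-comm) renaming (_≟_ to _≟ᵇ_)
open import Data.Empty using (⊥-elim)
open import Data.Fin using (Fin; zero; suc; toℕ; fromℕ<; combine; remQuot) renaming (_≤_ to _≤ᶠ_; _<_ to _<ᶠ_; _<?_ to _<ᶠ?_)
open import Data.Fin.Induction using () renaming (<-wellFounded to <ᶠ-wellFounded)
open import Data.Fin.Properties using (any?; all?; toℕ-injective; toℕ-fromℕ<; toℕ<n; remQuot-combine)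
open import Data.Fin.Subset using (Subset; _∈_; _∉_; _⊆_; _⊂_; _∪_; _∩_; ∣_∣; _─_; _-_; ⁅_⁆; Nonempty; ⊤) renaming (⊥ to ∅)
open import Data.Fin.Subset.Properties
open import Data.List using (List; []; _∷_; length; filter; map; _++_)
open import Data.List.Membership.Propositional using () renaming (_∈_ to _∈ˡ_)
open import Data.List.Membership.Propositional.Properties using (∈-map⁻; ∈-filter⁻)
open import Data.List.Properties using (length-++; filter-++)
open import Data.List.Relation.Binary.Disjoint.Propositional using (Disjoint)
open import Data.List.Relation.Unary.All using ([]; _∷_) renaming (lookup to All-lookup)
open import Data.List.Relation.Unary.AllPairs using ([]; _∷_)
open import Data.List.Relation.Unary.Any using (here; there)
open import Data.List.Relation.Unary.Unique.Propositional using (Unique)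
import Data.List.Relation.Unary.Unique.Propositional.Properties as Unique
open import Data.Nat hiding (_≟_)
open import Data.Nat.DivMod using (_/_; m/n*n≤m; m≡m%n+[m/n]*n; m%n≤n; m/n≤m)
open import Data.Nat.Induction using (<-wellFounded)
open import Data.Nat.Logarithm using (⌊log₂_⌋; ⌊log₂⌋-mono-≤; ⌊log₂[2^n]⌋≡n)
open import Data.Nat.Properties hiding (_≟_)
open import Data.Nat.Tactic.RingSolver using (solve-∀)
open import Data.Product using (Σ; ∃; _×_; _,_; proj₁; proj₂; uncurry)
open import Data.Sum using (_⊎_; inj₁; inj₂)
open import Data.Vec using (Vec; []; _∷_; take; drop; lookup; tabulate; here; there) renaming (_++_ to _++ᵛ_)
open import Data.Vec.Properties using (≡-dec; ∷-injectiveʳ; ++-injective; take++drop≡id; lookup∘tabulate; []=⇒lookup; lookup⇒[]=)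
open import Data.Vec.Properties using (lookup-zipWith; zipWith-assoc; zipWith-comm; zipWith-identityˡ)
open import Function using (_∘_)
open import Induction.WellFounded using (Acc; acc)
open import Relation.Binary.PropositionalEquality hiding (J)
open import Relation.Nullary using (Dec; yes; no; ¬_; contradiction; does; _×-dec_; _→-dec_; ¬?)
open import Relation.Unary using (Decidable)

private variable
  k m n : ℕ

-- Finite sums and products

∑ : (Vec Bool k → ℕ) → ℕ
∑ {zero}  f = f []
∑ {suc k} f = ∑ (f ∘ (true ∷_)) + ∑ (f ∘ (false ∷_))

∑-cong : {f g : Vec Bool k → ℕ} → (∀ x → f x ≡ g x) → ∑ f ≡ ∑ g
∑-cong {zero}  e = e []
∑-cong {suc k} e = cong₂ _+_ (∑-cong (e ∘ (true ∷_))) (∑-cong (e ∘ (false ∷_)))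

∑-mono : {f g : Vec Bool k → ℕ} → (∀ x → f x ≤ g x) → ∑ f ≤ ∑ g
∑-mono {zero}  e = e []
∑-mono {suc k} e = +-mono-≤ (∑-mono (e ∘ (true ∷_))) (∑-mono (e ∘ (false ∷_)))

∑-+ : (f g : Vec Bool k → ℕ) → ∑ (λ x → f x + g x) ≡ ∑ f + ∑ g
∑-+ {zero}  f g = refl
∑-+ {suc k} f g =
  trans (cong₂ _+_ (∑-+ (f ∘ (true ∷_)) (g ∘ (true ∷_))) (∑-+ (f ∘ (false ∷_)) (g ∘ (false ∷_))))
        (interchange (∑ (f ∘ (true ∷_))) (∑ (g ∘ (true ∷_))) (∑ (f ∘ (false ∷_))) (∑ (g ∘ (false ∷_))))
  where
  interchange : ∀ a b c d → a + b + (c + d) ≡ a + c + (b + d)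
  interchange = solve-∀

∑-*ˡ : ∀ c (f : Vec Bool k → ℕ) → ∑ (λ x → c * f x) ≡ c * ∑ f
∑-*ˡ {zero}  c f = refl
∑-*ˡ {suc k} c f =
  trans (cong₂ _+_ (∑-*ˡ c (f ∘ (true ∷_))) (∑-*ˡ c (f ∘ (false ∷_)))) (sym (*-distribˡ-+ c _ _))

∑-*ʳ : ∀ c (f : Vec Bool k → ℕ) → ∑ (λ x → f x * c) ≡ ∑ f * c
∑-*ʳ c f = trans (∑-cong (λ x → *-comm (f x) c)) (trans (∑-*ˡ c f) (*-comm c (∑ f)))

∑-const : ∀ k c → ∑ {k} (λ _ → c) ≡ 2 ^ k * c
∑-const zero    c = sym (*-identityˡ c)
∑-const (suc k) c = trans (cong₂ _+_ (∑-const k c) (∑-const k c)) (double (2 ^ k) c)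
  where
  double : ∀ p c → p * c + p * c ≡ 2 * p * c
  double = solve-∀

∑-swap : (f : Vec Bool k → Vec Bool m → ℕ) → ∑ (λ x → ∑ (f x)) ≡ ∑ (λ y → ∑ (λ x → f x y))
∑-swap {zero}  f = refl
∑-swap {suc k} f =
  trans (cong₂ _+_ (∑-swap (f ∘ (true ∷_))) (∑-swap (f ∘ (false ∷_))))
        (sym (∑-+ (λ y → ∑ (λ x → f (true ∷ x) y)) (λ y → ∑ (λ x → f (false ∷ x) y))))

∑-++ : ∀ k {m} (f : Vec Bool (k + m) → ℕ) → ∑ f ≡ ∑ {k} (λ x → ∑ {m} (λ y → f (x ++ᵛ y)))
∑-++ zero    f = refl
∑-++ (suc k) f = cong₂ _+_ (∑-++ k (f ∘ (true ∷_))) (∑-++ k (f ∘ (false ∷_)))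

term≤∑ : (f : Vec Bool k → ℕ) → ∀ x → f x ≤ ∑ f
term≤∑ f []          = ≤-refl
term≤∑ f (true  ∷ x) = ≤-trans (term≤∑ (f ∘ (true ∷_)) x) (m≤m+n _ _)
term≤∑ f (false ∷ x) = ≤-trans (term≤∑ (f ∘ (false ∷_)) x) (m≤n+m _ _)

∏ : (Fin n → ℕ) → ℕ
∏ {zero}  f = 1
∏ {suc n} f = f zero * ∏ (f ∘ suc)

∏-const : ∀ n c → ∏ {n} (λ _ → c) ≡ c ^ n
∏-const zero    c = refl
∏-const (suc n) c = cong (c *_) (∏-const n c)

∏≡1 : (f : Fin n → ℕ) → (∀ i → f i ≡ 1) → ∏ f ≡ 1
∏≡1 {zero}  f e = refl
∏≡1 {suc n} f e rewrite e zero | ∏≡1 (f ∘ suc) (e ∘ suc) = refl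

∏≡1⊎0 : (f : Fin n → ℕ) → (∀ i → f i ≡ 1 ⊎ f i ≡ 0) → (∀ i → f i ≡ 1) ⊎ ∏ f ≡ 0
∏≡1⊎0 {zero}  f h = inj₁ (λ ())
∏≡1⊎0 {suc n} f h with h zero | ∏≡1⊎0 (f ∘ suc) (h ∘ suc)
... | inj₂ e | _      rewrite e = inj₂ refl
... | inj₁ _ | inj₂ e rewrite e = inj₂ (*-zeroʳ (f zero))
... | inj₁ e | inj₁ t = inj₁ λ { zero → e ; (suc i) → t i }

∑< : ℕ → (ℕ → ℕ) → ℕ
∑< zero    f = 0
∑< (suc n) f = f n + ∑< n f

term≤∑< : ∀ n (f : ℕ → ℕ) {i} → i < n → f i ≤ ∑< n f
term≤∑< (suc n) f {i} (s≤s i≤n) with m≤n⇒m<n∨m≡n i≤n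
... | inj₁ i<n  = ≤-trans (term≤∑< n f i<n) (m≤n+m _ _)
... | inj₂ refl = m≤m+n _ _

∑<-bound : ∀ n (f : ℕ → ℕ) {c} → (∀ i → f i ≤ c) → ∑< n f ≤ n * c
∑<-bound zero    f h = z≤n
∑<-bound (suc n) f h = +-mono-≤ (h n) (∑<-bound n f h)

∑<-cong : ∀ n {f g : ℕ → ℕ} → (∀ i → f i ≡ g i) → ∑< n f ≡ ∑< n g
∑<-cong zero    e = refl
∑<-cong (suc n) e = cong₂ _+_ (e n) (∑<-cong n e)

∑<-*ʳ : ∀ n c (f : ℕ → ℕ) → ∑< n (λ i → f i * c) ≡ ∑< n f * c
∑<-*ʳ zero    c f = refl
∑<-*ʳ (suc n) c f = trans (cong (f n * c +_) (∑<-*ʳ n c f)) (sym (*-distribʳ-+ c (f n) _))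

∑-∑< : ∀ n (f : Vec Bool k → ℕ → ℕ) → ∑ (λ x → ∑< n (f x)) ≡ ∑< n (λ i → ∑ (λ x → f x i))
∑-∑< {k} zero f = trans (∑-const k 0) (*-zeroʳ (2 ^ k))
∑-∑< (suc n) f = trans (∑-+ (λ x → f x n) (λ x → ∑< n (f x))) (cong (∑ (λ x → f x n) +_) (∑-∑< n f))

-- Iverson brackets and counting

⟦_⟧ : {P : Set} → Dec P → ℕ
⟦ yes _ ⟧ = 1
⟦ no  _ ⟧ = 0

⟦yes⟧ : {P : Set} (d : Dec P) → P → ⟦ d ⟧ ≡ 1
⟦yes⟧ (yes _) _ = refl
⟦yes⟧ (no ¬p) p = contradiction p ¬p

⟦no⟧ : {P : Set} (d : Dec P) → ¬ P → ⟦ d ⟧ ≡ 0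
⟦no⟧ (yes p) ¬p = contradiction p ¬p
⟦no⟧ (no _)  _  = refl

⟦⟧≤ : {P : Set} (d : Dec P) {x : ℕ} → (P → 1 ≤ x) → ⟦ d ⟧ ≤ x
⟦⟧≤ (no  _) h = z≤n
⟦⟧≤ (yes p) h = h p

⟦⟧-mono : {P Q : Set} (d : Dec P) (e : Dec Q) → (P → Q) → ⟦ d ⟧ ≤ ⟦ e ⟧
⟦⟧-mono d e h = ⟦⟧≤ d (λ p → ≤-reflexive (sym (⟦yes⟧ e (h p))))

-- Induction on the list: subtracting the indicator of the head from `f` lowers the sum by one and,
-- as the list has no duplicates, leaves `f` unchanged on the tail.
length≤∑ : (f : Vec Bool k → ℕ) (xs : List (Vec Bool k)) → Unique xs → (∀ {x} → x ∈ˡ xs → 1 ≤ f x) → length xs ≤ ∑ f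
length≤∑ f []       _          h = z≤n
length≤∑ f (x ∷ xs) (x# ∷ uniq) h = begin
  suc (length xs)                           ≤⟨ s≤s (length≤∑ f′ xs uniq h′) ⟩
  1 + ∑ f′                                  ≤⟨ +-monoˡ-≤ (∑ f′) (≤-trans (≤-reflexive (sym (⟦yes⟧ (x ≟ᵛ x) refl))) (term≤∑ at-x x)) ⟩
  ∑ at-x + ∑ f′                             ≡⟨ ∑-+ at-x f′ ⟨
  ∑ (λ y → at-x y + f′ y)                   ≡⟨ ∑-cong (λ y → m+[n∸m]≡n (at-x≤f y)) ⟩
  ∑ f                                       ∎
  where
  open ≤-Reasoning
  _≟ᵛ_ = ≡-dec _≟ᵇ_
  at-x f′ : Vec Bool _ → ℕ
  at-x y = ⟦ y ≟ᵛ x ⟧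
  f′ y   = f y ∸ at-x y
  at-x≤f : ∀ y → at-x y ≤ f y
  at-x≤f y with y ≟ᵛ x
  ... | yes refl = h (here refl)
  ... | no  _    = z≤n
  h′ : ∀ {y} → y ∈ˡ xs → 1 ≤ f′ y
  h′ {y} y∈ rewrite ⟦no⟧ (y ≟ᵛ x) (λ { refl → All-lookup x# y∈ refl }) = h (there y∈)

words : ∀ k → List (Vec Bool k)
words zero    = [] ∷ []
words (suc k) = map (true ∷_) (words k) ++ map (false ∷_) (words k)

words-unique : ∀ k → Unique (words k)
words-unique zero    = [] ∷ []
words-unique (suc k) =
  Unique.++⁺ (Unique.map⁺ ∷-injectiveʳ (words-unique k)) (Unique.map⁺ ∷-injectiveʳ (words-unique k)) disj
  where
  disj : Disjoint (map (true ∷_) (words k)) (map (false ∷_) (words k))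
  disj (p , q) with ∈-map⁻ (true ∷_) p | ∈-map⁻ (false ∷_) q
  ... | _ , _ , refl | _ , _ , ()

length-filter-map : {A B : Set} {P : B → Set} (P? : Decidable P) (g : A → B) (xs : List A) →
                    length (filter P? (map g xs)) ≡ length (filter (P? ∘ g) xs)
length-filter-map P? g []       = refl
length-filter-map P? g (x ∷ xs) with P? (g x)
... | yes _ = cong suc (length-filter-map P? g xs)
... | no  _ = length-filter-map P? g xs

-- Through this identity the counting bound, which speaks of duplicate-free lists of circuits,
-- becomes a bound on a sum over all subsets.
length-filter-words : {P : Vec Bool k → Set} (P? : Decidable P) → length (filter P? (words k)) ≡ ∑ (λ x → ⟦ P? x ⟧)
length-filter-words {zero} P? with P? []
... | yes _ = refl
... | no  _ = refl
length-filter-words {suc k} P? = begin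
  length (filter P? (map (true ∷_) (words k) ++ map (false ∷_) (words k)))
    ≡⟨ cong length (filter-++ P? (map (true ∷_) (words k)) _) ⟩
  length (filter P? (map (true ∷_) (words k)) ++ filter P? (map (false ∷_) (words k)))
    ≡⟨ length-++ (filter P? (map (true ∷_) (words k))) ⟩
  length (filter P? (map (true ∷_) (words k))) + length (filter P? (map (false ∷_) (words k)))
    ≡⟨ cong₂ _+_ (length-filter-map P? (true ∷_) (words k)) (length-filter-map P? (false ∷_) (words k)) ⟩
  length (filter (P? ∘ (true ∷_)) (words k)) + length (filter (P? ∘ (false ∷_)) (words k))
    ≡⟨ cong₂ _+_ (length-filter-words (P? ∘ (true ∷_))) (length-filter-words (P? ∘ (false ∷_))) ⟩
  ∑ (λ x → ⟦ P? x ⟧) ∎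
  where open ≡-Reasoning

-- Independent blocks of random bits

block : Fin n → Vec Bool (n * k) → Vec Bool k
block {k = k} zero    ρ = take k ρ
block {k = k} (suc i) ρ = block i (drop k ρ)

take-++ : {A : Set} (x : Vec A m) (y : Vec A n) → take m (x ++ᵛ y) ≡ x
take-++ {m = m} x y = proj₁ (++-injective (take m (x ++ᵛ y)) x (take++drop≡id m (x ++ᵛ y)))

drop-++ : {A : Set} (x : Vec A m) (y : Vec A n) → drop m (x ++ᵛ y) ≡ y
drop-++ {m = m} x y = proj₂ (++-injective (take m (x ++ᵛ y)) x (take++drop≡id m (x ++ᵛ y)))

-- Independence of the blocks: once the first block is split off, its factor is constant in the
-- remaining bits.
∑-blocks : ∀ n {k} (φ : Fin n → Vec Bool k → ℕ) → ∑ (λ ρ → ∏ (λ i → φ i (block i ρ))) ≡ ∏ (λ i → ∑ (φ i))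
∑-blocks zero    φ = refl
∑-blocks (suc n) {k} φ = begin
  ∑ (λ ρ → ∏ (λ i → φ i (block i ρ)))
    ≡⟨ ∑-++ k _ ⟩
  ∑ {k} (λ x → ∑ (λ y → φ zero (take k (x ++ᵛ y)) * ∏ (λ i → φ (suc i) (block i (drop k (x ++ᵛ y))))))
    ≡⟨ ∑-cong (λ x → ∑-cong (λ y → cong₂ (λ u w → φ zero u * ∏ (λ i → φ (suc i) (block i w))) (take-++ x y) (drop-++ x y))) ⟩
  ∑ {k} (λ x → ∑ (λ y → φ zero x * ∏ (λ i → φ (suc i) (block i y))))
    ≡⟨ ∑-cong (λ x → trans (∑-*ˡ (φ zero x) (λ y → ∏ (λ i → φ (suc i) (block i y)))) (cong (φ zero x *_) (∑-blocks n (φ ∘ suc)))) ⟩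
  ∑ {k} (λ x → φ zero x * ∏ (λ i → ∑ (φ (suc i))))
    ≡⟨ ∑-*ʳ _ (φ zero) ⟩
  ∏ (λ i → ∑ (φ i)) ∎
  where open ≡-Reasoning

-- An event of probability a / 2 ^ k. The parity split makes the count obey ⌈a/2⌉ + ⌊a/2⌋ = a.
coin : ℕ → Vec Bool k → Bool
coin zero    []          = false
coin (suc _) []          = true
coin a       (true  ∷ x) = coin ⌈ a /2⌉ x
coin a       (false ∷ x) = coin ⌊ a /2⌋ x

bit : Bool → ℕ
bit true  = 1
bit false = 0

∑-coin : ∀ k a → a ≤ 2 ^ k → ∑ {k} (λ x → bit (coin a x)) ≡ a
∑-coin zero zero          _ = refl
∑-coin zero (suc zero)    _ = refl
∑-coin zero (suc (suc a)) (s≤s ())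
∑-coin (suc k) a          a≤ = begin
  ∑ {suc k} (λ x → bit (coin a x))
    ≡⟨ cong₂ _+_ (∑-cong (λ x → cong bit (coin-true a x))) (∑-cong (λ x → cong bit (coin-false a x))) ⟩
  ∑ {k} (λ x → bit (coin ⌈ a /2⌉ x)) + ∑ {k} (λ x → bit (coin ⌊ a /2⌋ x))
    ≡⟨ cong₂ _+_ (∑-coin k ⌈ a /2⌉ ⌈a/2⌉≤) (∑-coin k ⌊ a /2⌋ (≤-trans (⌊n/2⌋≤⌈n/2⌉ a) ⌈a/2⌉≤)) ⟩
  ⌈ a /2⌉ + ⌊ a /2⌋
    ≡⟨ trans (+-comm ⌈ a /2⌉ _) (⌊n/2⌋+⌈n/2⌉≡n a) ⟩
  a ∎
  where
  open ≡-Reasoning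
  coin-true : ∀ a (x : Vec Bool k) → coin a (true ∷ x) ≡ coin ⌈ a /2⌉ x
  coin-true zero    x = refl
  coin-true (suc _) x = refl
  coin-false : ∀ a (x : Vec Bool k) → coin a (false ∷ x) ≡ coin ⌊ a /2⌋ x
  coin-false zero    x = refl
  coin-false (suc _) x = refl
  ⌈a/2⌉≤ : ⌈ a /2⌉ ≤ 2 ^ k
  ⌈a/2⌉≤ = ≤-trans (⌈n/2⌉-mono a≤)
    (≤-reflexive (trans (cong (λ y → ⌈ 2 ^ k + y /2⌉) (+-identityʳ (2 ^ k))) (sym (n≡⌈n+n/2⌉ (2 ^ k)))))

-- Each element is kept independently with probability a / 2 ^ k.
sample : ℕ → Vec Bool (m * k) → Subset m
sample a x = tabulate (λ e → coin a (block e x))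

-- For `D = 2 ^ k` this is the number of random strings whose sample contains the set `X`, that is,
-- `D ^ m` times the probability `(a / D) ^ ∣ X ∣`. Counting strings avoids division throughout.
weight : ℕ → ℕ → Subset m → ℕ
weight D a []          = 1
weight D a (true  ∷ X) = a * weight D a X
weight D a (false ∷ X) = D * weight D a X

factor : Bool → Bool → ℕ
factor true  b = bit b
factor false b = 1

factor≡1⊎0 : ∀ a b → factor a b ≡ 1 ⊎ factor a b ≡ 0
factor≡1⊎0 false b     = inj₁ refl
factor≡1⊎0 true  true  = inj₁ refl
factor≡1⊎0 true  false = inj₂ refl

-- Containment becomes a product with one factor per element, the form in which `∑-blocks` applies.
⟦⊆tabulate⟧ : (X : Subset m) (g : Fin m → Bool) → ⟦ X ⊆? tabulate g ⟧ ≡ ∏ (λ e → factor (lookup X e) (g e))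
⟦⊆tabulate⟧ X g with X ⊆? tabulate g | ∏≡1⊎0 (λ e → factor (lookup X e) (g e)) (λ e → factor≡1⊎0 (lookup X e) (g e))
... | yes X⊆ | _      = sym (∏≡1 _ one)
  where
  one : ∀ e → factor (lookup X e) (g e) ≡ 1
  one e with lookup X e in eq
  ... | false = refl
  ... | true  = cong bit (trans (sym (lookup∘tabulate g e)) ([]=⇒lookup (X⊆ (lookup⇒[]= e X eq))))
... | no  _  | inj₂ z = sym z
... | no  X⊈ | inj₁ o = ⊥-elim (X⊈ X⊆)
  where
  bit≡1 : ∀ b → bit b ≡ 1 → b ≡ true
  bit≡1 true _ = refl
  X⊆ : X ⊆ tabulate g
  X⊆ {e} e∈ with o e
  ... | p rewrite []=⇒lookup e∈ = lookup⇒[]= e _ (trans (lookup∘tabulate g e) (bit≡1 (g e) p))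

∏-weight : ∀ (X : Subset m) k a → a ≤ 2 ^ k → ∏ (λ e → ∑ {k} (λ x → factor (lookup X e) (coin a x))) ≡ weight (2 ^ k) a X
∏-weight []          k a a≤ = refl
∏-weight (true  ∷ X) k a a≤ = cong₂ _*_ (∑-coin k a a≤) (∏-weight X k a a≤)
∏-weight (false ∷ X) k a a≤ = cong₂ _*_ (trans (∑-const k 1) (*-identityʳ (2 ^ k))) (∏-weight X k a a≤)

∑-⊆sample : ∀ (X : Subset m) k a → a ≤ 2 ^ k → ∑ {m * k} (λ x → ⟦ X ⊆? sample a x ⟧) ≡ weight (2 ^ k) a X
∑-⊆sample {m} X k a a≤ = begin
  ∑ {m * k} (λ x → ⟦ X ⊆? sample a x ⟧)
    ≡⟨ ∑-cong (λ x → ⟦⊆tabulate⟧ X (λ e → coin a (block e x))) ⟩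
  ∑ {m * k} (λ x → ∏ (λ e → factor (lookup X e) (coin a (block e x))))
    ≡⟨ ∑-blocks m (λ e x → factor (lookup X e) (coin a x)) ⟩
  ∏ (λ e → ∑ {k} (λ x → factor (lookup X e) (coin a x)))
    ≡⟨ ∏-weight X k a a≤ ⟩
  weight (2 ^ k) a X ∎
  where open ≡-Reasoning

weight-card : ∀ D a (X : Subset m) → weight D a X * D ^ ∣ X ∣ ≡ a ^ ∣ X ∣ * D ^ m
weight-card D a []          = refl
weight-card {suc m} D a (true  ∷ X) = begin
  a * weight D a X * (D * D ^ ∣ X ∣)   ≡⟨ r a (weight D a X) D (D ^ ∣ X ∣) ⟩
  a * D * (weight D a X * D ^ ∣ X ∣)   ≡⟨ cong (a * D *_) (weight-card D a X) ⟩
  a * D * (a ^ ∣ X ∣ * D ^ m)          ≡⟨ r′ a D (a ^ ∣ X ∣) (D ^ m) ⟩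
  a * a ^ ∣ X ∣ * (D * D ^ m)          ∎
  where
  open ≡-Reasoning
  r : ∀ a w d p → a * w * (d * p) ≡ a * d * (w * p)
  r = solve-∀
  r′ : ∀ a d p q → a * d * (p * q) ≡ a * p * (d * q)
  r′ = solve-∀
weight-card {suc m} D a (false ∷ X) = begin
  D * weight D a X * D ^ ∣ X ∣         ≡⟨ *-assoc D _ _ ⟩
  D * (weight D a X * D ^ ∣ X ∣)       ≡⟨ cong (D *_) (weight-card D a X) ⟩
  D * (a ^ ∣ X ∣ * D ^ m)              ≡⟨ r D (a ^ ∣ X ∣) (D ^ m) ⟩
  a ^ ∣ X ∣ * (D * D ^ m)              ∎
  where
  open ≡-Reasoning
  r : ∀ d p q → d * (p * q) ≡ p * (d * q)
  r = solve-∀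

-- Each element of `Y ─ X` turns one factor `D` into `a`: once `X` is sampled, only the elements of
-- `Y` outside `X` still cost probability.
weight-∪ : ∀ D a (X Y : Subset m) → weight D a (X ∪ Y) * D ^ ∣ Y ─ X ∣ ≡ weight D a X * a ^ ∣ Y ─ X ∣
weight-∪ D a []          []          = refl
weight-∪ D a (true  ∷ X) (true  ∷ Y) = trans (*-assoc a _ _) (trans (cong (a *_) (weight-∪ D a X Y)) (sym (*-assoc a _ _)))
weight-∪ D a (true  ∷ X) (false ∷ Y) = trans (*-assoc a _ _) (trans (cong (a *_) (weight-∪ D a X Y)) (sym (*-assoc a _ _)))
weight-∪ D a (false ∷ X) (false ∷ Y) = trans (*-assoc D _ _) (trans (cong (D *_) (weight-∪ D a X Y)) (sym (*-assoc D _ _)))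
weight-∪ D a (false ∷ X) (true  ∷ Y) = begin
  a * weight D a (X ∪ Y) * (D * D ^ j)   ≡⟨ r a (weight D a (X ∪ Y)) D (D ^ j) ⟩
  a * D * (weight D a (X ∪ Y) * D ^ j)   ≡⟨ cong (a * D *_) (weight-∪ D a X Y) ⟩
  a * D * (weight D a X * a ^ j)         ≡⟨ r′ a D (weight D a X) (a ^ j) ⟩
  D * weight D a X * (a * a ^ j)         ∎
  where
  open ≡-Reasoning
  j = ∣ Y ─ X ∣
  r : ∀ a w d p → a * w * (d * p) ≡ a * d * (w * p)
  r = solve-∀
  r′ : ∀ a d w p → a * d * (w * p) ≡ d * w * (a * p)
  r′ = solve-∀

-- Elements of `X ∩ Y` count once on each side, those of `Y ─ X` twice. The additive form avoids
-- truncated subtraction.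
∣⊕∣ : (X Y : Subset m) → ∣ X ⊕ Y ∣ + ∣ Y ∣ ≡ ∣ X ∣ + 2 * ∣ Y ─ X ∣
∣⊕∣ []          []          = refl
∣⊕∣ (true  ∷ X) (true  ∷ Y) = trans (+-suc _ _) (cong suc (∣⊕∣ X Y))
∣⊕∣ (true  ∷ X) (false ∷ Y) = cong suc (∣⊕∣ X Y)
∣⊕∣ (false ∷ X) (false ∷ Y) = ∣⊕∣ X Y
∣⊕∣ (false ∷ X) (true  ∷ Y) = begin
  suc (∣ X ⊕ Y ∣ + suc ∣ Y ∣)        ≡⟨ cong suc (+-suc _ _) ⟩
  2 + (∣ X ⊕ Y ∣ + ∣ Y ∣)            ≡⟨ cong (2 +_) (∣⊕∣ X Y) ⟩
  2 + (∣ X ∣ + 2 * ∣ Y ─ X ∣)        ≡⟨ r ∣ X ∣ ∣ Y ─ X ∣ ⟩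
  ∣ X ∣ + 2 * suc ∣ Y ─ X ∣          ∎
  where
  open ≡-Reasoning
  r : ∀ x j → 2 + (x + 2 * j) ≡ x + 2 * suc j
  r = solve-∀

-- Powers

^-distribʳ-* : ∀ x y k → (x * y) ^ k ≡ x ^ k * y ^ k
^-distribʳ-* x y zero    = refl
^-distribʳ-* x y (suc k) = trans (cong (x * y *_) (^-distribʳ-* x y k)) (swap x y (x ^ k) (y ^ k))
  where
  swap : ∀ x y p q → x * y * (p * q) ≡ x * p * (y * q)
  swap = solve-∀

^-swap : ∀ x i j → (x ^ i) ^ j ≡ (x ^ j) ^ i
^-swap x i j = trans (^-*-assoc x i j) (trans (cong (x ^_) (*-comm i j)) (sym (^-*-assoc x j i)))

^-cancelʳ-≤ : ∀ k .{{_ : NonZero k}} {x y} → x ^ k ≤ y ^ k → x ≤ y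
^-cancelʳ-≤ k {x} {y} h with x ≤? y
... | yes x≤y = x≤y
... | no  x≰y = ⊥-elim (<⇒≱ (^-monoˡ-< k (≰⇒> x≰y)) h)

n<2^n : ∀ n → n < 2 ^ n
n<2^n zero    = s≤s z≤n
n<2^n (suc n) = +-mono-≤ (m^n>0 2 n) (≤-trans (n<2^n n) (m≤m+n _ 0))

-- Bernoulli's inequality for `(1 + g / x) ^ k`, with denominators cleared.
bernoulli : ∀ x g k → x ^ k * (x + k * g) ≤ (x + g) ^ k * x
bernoulli x g zero    = ≤-reflexive (cong (1 *_) (+-identityʳ x))
bernoulli x g (suc k) = begin
  x * x ^ k * (x + suc k * g)                    ≤⟨ m≤m+n _ (x ^ k * (k * g * g)) ⟩
  x * x ^ k * (x + suc k * g) + x ^ k * (k * g * g) ≡⟨ r x (x ^ k) k g ⟩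
  (x + g) * (x ^ k * (x + k * g))                ≤⟨ *-monoʳ-≤ (x + g) (bernoulli x g k) ⟩
  (x + g) * ((x + g) ^ k * x)                    ≡⟨ *-assoc (x + g) _ x ⟨
  (x + g) ^ suc k * x                            ∎
  where
  open ≤-Reasoning
  r : ∀ x p k g → x * p * (x + suc k * g) + p * (k * g * g) ≡ (x + g) * (p * (x + k * g))
  r = solve-∀

-- With `x` misses and `g` hits, a hit has probability at least `1 / Q`, and then `Q` trials all
-- miss with probability at most 1/2: Bernoulli applies, as `Q * g ≥ x`.
halving : ∀ x g Q .{{_ : NonZero Q}} → x + g ≤ g * Q → 2 * x ^ Q ≤ (x + g) ^ Q
halving zero      g (suc Q) h = z≤n
halving x@(suc _) g Q       h = *-cancelʳ-≤ _ _ x (begin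
  2 * x ^ Q * x          ≡⟨ r x (x ^ Q) ⟩
  x ^ Q * (x + x)        ≤⟨ *-monoʳ-≤ (x ^ Q) (+-monoʳ-≤ x (≤-trans (m≤m+n x g) (≤-trans h (≤-reflexive (*-comm g Q))))) ⟩
  x ^ Q * (x + Q * g)    ≤⟨ bernoulli x g Q ⟩
  (x + g) ^ Q * x        ∎)
  where
  open ≤-Reasoning
  r : ∀ x p → 2 * p * x ≡ p * (x + x)
  r = solve-∀

amplification : ∀ x g Q .{{_ : NonZero Q}} t → x + g ≤ g * Q → 2 ^ t * x ^ (Q * t) ≤ (x + g) ^ (Q * t)
amplification x g Q t h = begin
  2 ^ t * x ^ (Q * t)        ≡⟨ cong (2 ^ t *_) (^-*-assoc x Q t) ⟨
  2 ^ t * (x ^ Q) ^ t        ≡⟨ ^-distribʳ-* 2 (x ^ Q) t ⟨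
  (2 * x ^ Q) ^ t            ≤⟨ ^-monoˡ-≤ t (halving x g Q h) ⟩
  ((x + g) ^ Q) ^ t          ≡⟨ ^-*-assoc (x + g) Q t ⟩
  (x + g) ^ (Q * t)          ∎
  where open ≤-Reasoning

-- With `a = k + j` this is Bernoulli's inequality for `(1 - 1 / (a + 1)) ^ k`, with denominators
-- cleared.
suc-^-≤ : ∀ k j → suc (k + j) ^ k * suc j ≤ suc (k + j) * (k + j) ^ k
suc-^-≤ zero    j = ≤-reflexive (trans (*-identityˡ (suc j)) (sym (*-identityʳ (suc j))))
suc-^-≤ (suc k) j = begin
  b * b ^ k * suc j                      ≡⟨ r b (b ^ k) (suc j) ⟩
  b ^ k * (b * suc j)                    ≤⟨ *-monoʳ-≤ (b ^ k) (≤-trans (m≤m+n _ k) (≤-reflexive (r′ k j))) ⟩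
  b ^ k * (suc (suc j) * a)              ≡⟨ *-assoc (b ^ k) _ a ⟨
  b ^ k * suc (suc j) * a                ≤⟨ *-monoˡ-≤ a ih ⟩
  b * a ^ k * a                          ≡⟨ r″ b (a ^ k) a ⟩
  b * (a * a ^ k)                        ∎
  where
  open ≤-Reasoning
  a = suc (k + j)
  b = suc a
  ih : b ^ k * suc (suc j) ≤ b * a ^ k
  ih = subst (λ z → suc z ^ k * suc (suc j) ≤ suc z * z ^ k) (+-suc k j) (suc-^-≤ k (suc j))
  r : ∀ b p s → b * p * s ≡ p * (b * s)
  r = solve-∀
  r′ : ∀ k j → suc (suc (k + j)) * suc j + k ≡ suc (suc j) * suc (k + j)
  r′ = solve-∀
  r″ : ∀ b p a → b * p * a ≡ b * (a * p)
  r″ = solve-∀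

-- Controls the rounding of the numerator `a` to an integer. For `a = k + j` the loss is at most
-- `(a + 1) / (j + 1)`, which is at most 2 because `k ≤ j`.
suc-^≤2*^ : ∀ a k → 2 * k ≤ a → suc a ^ k ≤ 2 * a ^ k
suc-^≤2*^ a k 2k≤a with m≤n⇒∃[o]m+o≡n (≤-trans (m≤m+n k (k + 0)) 2k≤a)
... | j , refl = *-cancelʳ-≤ _ _ (suc (k + j)) (begin
  suc (k + j) ^ k * suc (k + j)         ≤⟨ *-monoʳ-≤ (suc (k + j) ^ k) k+j<2+2j ⟩
  suc (k + j) ^ k * (suc j * 2)         ≡⟨ *-assoc (suc (k + j) ^ k) (suc j) 2 ⟨
  suc (k + j) ^ k * suc j * 2           ≤⟨ *-monoˡ-≤ 2 (suc-^-≤ k j) ⟩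
  suc (k + j) * (k + j) ^ k * 2         ≡⟨ r (suc (k + j)) ((k + j) ^ k) ⟩
  2 * (k + j) ^ k * suc (k + j)         ∎)
  where
  open ≤-Reasoning
  r : ∀ b p → b * p * 2 ≡ 2 * p * b
  r = solve-∀
  k≤j : k ≤ j
  k≤j = +-cancelˡ-≤ k k j (≤-trans (≤-reflexive (cong (k +_) (sym (+-identityʳ k)))) 2k≤a)
  r′ : ∀ j → suc (j + j) + 1 ≡ suc j * 2
  r′ = solve-∀
  k+j<2+2j : suc (k + j) ≤ suc j * 2
  k+j<2+2j = ≤-trans (s≤s (+-monoˡ-≤ j k≤j)) (≤-trans (m≤m+n _ 1) (≤-reflexive (r′ j)))

-- The inclusion probability a / D

crossing : {P : ℕ → Set} → Decidable P → ∀ lo d → P lo → ¬ P (lo + d) → ∃ λ a → lo ≤ a × P a × ¬ P (suc a)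
crossing {P} P? lo zero    p ¬q = contradiction (subst P (sym (+-identityʳ lo)) p) ¬q
crossing {P} P? lo (suc d) p ¬q with P? (suc lo)
... | no ¬r = lo , ≤-refl , p , ¬r
... | yes r with crossing P? (suc lo) d r (λ s → ¬q (subst P (sym (+-suc lo d)) s))
...   | a , lo≤a , pa , ¬pa = a , ≤-trans (n≤1+n lo) lo≤a , pa , ¬pa

-- num / D is, up to rounding, n ^ (- A / ℓ).
record Probability (n A D ℓ : ℕ) : Set where
  field
    num       : ℕ
    num>0     : 1 ≤ num
    num≤D     : num ≤ D
    num-upper : num ^ ℓ * n ^ A ≤ D ^ ℓ
    num-lower : D ^ ℓ ≤ num ^ ℓ * n ^ suc A

-- The numerator is where an upward search from `2 * n` first has a successor violating `num-upper`.
-- Starting there makes the step to the successor cost at most a factor 2 in the `ℓ`-th power, since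
-- `ℓ ≤ n`; the extra factor `n` in `num-lower` absorbs it.
probability : ∀ n A D ℓ .{{_ : NonZero ℓ}} .{{_ : NonZero A}} → 2 ≤ n → ℓ ≤ n → n ^ (2 + A) ≤ D → Probability n A D ℓ
probability n A D ℓ 2≤n ℓ≤n n^≤D = record
  { num = a ; num>0 = a>0 ; num≤D = a≤D ; num-upper = upper ; num-lower = lower }
  where
  open ≤-Reasoning
  instance
    n≢0 : NonZero n
    n≢0 = >-nonZero (≤-trans (s≤s z≤n) 2≤n)
  2n≤D : 2 * n ≤ D
  2n≤D = begin
    2 * n           ≤⟨ *-monoˡ-≤ n 2≤n ⟩
    n * n           ≡⟨ cong (n *_) (*-identityʳ n) ⟨
    n ^ 2           ≤⟨ ^-monoʳ-≤ n (m≤m+n 2 A) ⟩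
    n ^ (2 + A)     ≤⟨ n^≤D ⟩
    D               ∎
  instance
    D≢0 : NonZero D
    D≢0 = >-nonZero (≤-trans (≤-trans (s≤s z≤n) 2≤n) (≤-trans (m≤m+n n (n + 0)) 2n≤D))
  at-2n : (2 * n) ^ ℓ * n ^ A ≤ D ^ ℓ
  at-2n = begin
    (2 * n) ^ ℓ * n ^ A           ≤⟨ *-mono-≤ (^-monoˡ-≤ ℓ (*-monoˡ-≤ n 2≤n)) (^-monoʳ-≤ n (m≤m*n A ℓ)) ⟩
    (n * n) ^ ℓ * n ^ (A * ℓ)     ≡⟨ cong ((n * n) ^ ℓ *_) (^-*-assoc n A ℓ) ⟨
    (n * n) ^ ℓ * (n ^ A) ^ ℓ     ≡⟨ ^-distribʳ-* (n * n) (n ^ A) ℓ ⟨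
    (n * n * n ^ A) ^ ℓ           ≡⟨ cong (_^ ℓ) (*-assoc n n (n ^ A)) ⟩
    (n ^ (2 + A)) ^ ℓ             ≤⟨ ^-monoˡ-≤ ℓ n^≤D ⟩
    D ^ ℓ                         ∎
  -- The search ends by `D` at the latest, because `n ^ A ≥ 2`.
  at-D : ¬ (D ^ ℓ * n ^ A ≤ D ^ ℓ)
  at-D = <⇒≱ (m<m*n (D ^ ℓ) (n ^ A) {{m^n≢0 D ℓ}} (≤-trans 2≤n (≤-trans (≤-reflexive (sym (*-identityʳ n))) (^-monoʳ-≤ n (>-nonZero⁻¹ A)))))
  found = crossing (λ a → a ^ ℓ * n ^ A ≤? D ^ ℓ) (2 * n) (D ∸ 2 * n) at-2n
            (subst (λ z → ¬ (z ^ ℓ * n ^ A ≤ D ^ ℓ)) (sym (m+[n∸m]≡n 2n≤D)) at-D)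
  a = proj₁ found
  2n≤a = proj₁ (proj₂ found)
  upper = proj₁ (proj₂ (proj₂ found))
  a>0 = ≤-trans (≤-trans (s≤s z≤n) 2≤n) (≤-trans (m≤m+n n (n + 0)) 2n≤a)
  a≤D : a ≤ D
  a≤D = ^-cancelʳ-≤ ℓ (≤-trans (m≤m*n (a ^ ℓ) (n ^ A) {{m^n≢0 n A}}) upper)
  lower : D ^ ℓ ≤ a ^ ℓ * n ^ suc A
  lower = begin
    D ^ ℓ                         ≤⟨ <⇒≤ (≰⇒> (proj₂ (proj₂ (proj₂ found)))) ⟩
    suc a ^ ℓ * n ^ A             ≤⟨ *-monoˡ-≤ (n ^ A) (suc-^≤2*^ a ℓ (≤-trans (*-monoʳ-≤ 2 ℓ≤n) 2n≤a)) ⟩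
    2 * a ^ ℓ * n ^ A             ≤⟨ *-monoˡ-≤ (n ^ A) (*-monoˡ-≤ (a ^ ℓ) 2≤n) ⟩
    n * a ^ ℓ * n ^ A             ≡⟨ cong (_* n ^ A) (*-comm n (a ^ ℓ)) ⟩
    a ^ ℓ * n * n ^ A             ≡⟨ *-assoc (a ^ ℓ) n (n ^ A) ⟩
    a ^ ℓ * n ^ suc A             ∎

-- Both sides are compared after raising to the power `ℓ`, where the hypothesis can be applied `j`
-- times and only the exponents of `n` remain to be compared.
power-upper : ∀ {a D n κ ℓ} .{{_ : NonZero ℓ}} .{{_ : NonZero n}} → a ^ ℓ * n ^ (8 * κ) ≤ D ^ ℓ →
              ∀ j α → α * ℓ ≤ 8 * j → a ^ j * n ^ (κ * α) ≤ D ^ j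
power-upper {a} {D} {n} {κ} {ℓ} upper j α αℓ≤8j = ^-cancelʳ-≤ ℓ (begin
  (a ^ j * n ^ (κ * α)) ^ ℓ               ≡⟨ ^-distribʳ-* (a ^ j) (n ^ (κ * α)) ℓ ⟩
  (a ^ j) ^ ℓ * (n ^ (κ * α)) ^ ℓ         ≡⟨ cong₂ _*_ (^-swap a j ℓ) (^-*-assoc n (κ * α) ℓ) ⟩
  (a ^ ℓ) ^ j * n ^ (κ * α * ℓ)           ≤⟨ *-monoʳ-≤ ((a ^ ℓ) ^ j) (^-monoʳ-≤ n exponent) ⟩
  (a ^ ℓ) ^ j * n ^ (8 * κ * j)           ≡⟨ cong ((a ^ ℓ) ^ j *_) (^-*-assoc n (8 * κ) j) ⟨
  (a ^ ℓ) ^ j * (n ^ (8 * κ)) ^ j         ≡⟨ ^-distribʳ-* (a ^ ℓ) (n ^ (8 * κ)) j ⟨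
  (a ^ ℓ * n ^ (8 * κ)) ^ j               ≤⟨ ^-monoˡ-≤ j upper ⟩
  (D ^ ℓ) ^ j                             ≡⟨ ^-swap D ℓ j ⟩
  (D ^ j) ^ ℓ                             ∎)
  where
  open ≤-Reasoning
  r : ∀ κ j → κ * (8 * j) ≡ 8 * κ * j
  r = solve-∀
  exponent : κ * α * ℓ ≤ 8 * κ * j
  exponent = ≤-trans (≤-reflexive (*-assoc κ α ℓ)) (≤-trans (*-monoʳ-≤ κ αℓ≤8j) (≤-reflexive (r κ j)))

-- The exponent `c` is padded to `2 * ℓ`, where the square of the hypothesis applies; the `d` added
-- factors satisfy `a ≤ D` and cancel at the end.
power-lower : ∀ {a D ℓ p} .{{_ : NonZero a}} → a ≤ D → D ^ ℓ ≤ a ^ ℓ * p →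
              ∀ c → c ≤ 2 * ℓ → D ^ c ≤ a ^ c * p ^ 2
power-lower {a} {D} {ℓ} {p} a≤D lower c c≤2ℓ with m≤n⇒∃[o]m+o≡n c≤2ℓ
... | d , c+d≡2ℓ = *-cancelʳ-≤ _ _ (a ^ d) {{m^n≢0 a d}} (begin
  D ^ c * a ^ d              ≤⟨ *-monoʳ-≤ (D ^ c) (^-monoˡ-≤ d a≤D) ⟩
  D ^ c * D ^ d              ≡⟨ split D ⟩
  (D ^ ℓ) ^ 2                ≤⟨ ^-monoˡ-≤ 2 lower ⟩
  (a ^ ℓ * p) ^ 2            ≡⟨ ^-distribʳ-* (a ^ ℓ) p 2 ⟩
  (a ^ ℓ) ^ 2 * p ^ 2        ≡⟨ cong (_* p ^ 2) (split a) ⟨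
  a ^ c * a ^ d * p ^ 2      ≡⟨ r (a ^ c) (a ^ d) (p ^ 2) ⟩
  a ^ c * p ^ 2 * a ^ d      ∎)
  where
  open ≤-Reasoning
  split : ∀ x → x ^ c * x ^ d ≡ (x ^ ℓ) ^ 2
  split x = trans (sym (^-distribˡ-+-* x c d)) (trans (cong (x ^_) (trans c+d≡2ℓ (*-comm 2 ℓ))) (sym (^-*-assoc x ℓ 2)))
  r : ∀ x y z → x * y * z ≡ x * z * y
  r = solve-∀

m<2^[log₂m+1] : ∀ m → m < 2 ^ suc ⌊log₂ m ⌋
m<2^[log₂m+1] m with 2 ^ suc ⌊log₂ m ⌋ ≤? m
... | no  h = ≰⇒> h
... | yes h = ⊥-elim (<-irrefl refl (≤-trans (≤-reflexive (sym (⌊log₂[2^n]⌋≡n (suc ⌊log₂ m ⌋)))) (⌊log₂⌋-mono-≤ h)))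

-- Symmetric difference

⊕-assoc : (x y z : Vec Bool k) → (x ⊕ y) ⊕ z ≡ x ⊕ (y ⊕ z)
⊕-assoc = zipWith-assoc xor-assoc

⊕-comm : (x y : Vec Bool k) → x ⊕ y ≡ y ⊕ x
⊕-comm = zipWith-comm xor-comm

⊕-identityˡ : (x : Vec Bool k) → zeroVec ⊕ x ≡ x
⊕-identityˡ = zipWith-identityˡ (λ _ → refl)

⊕-identityʳ : (x : Vec Bool k) → x ⊕ zeroVec ≡ x
⊕-identityʳ x = trans (⊕-comm x zeroVec) (⊕-identityˡ x)

⊕-self : (x : Vec Bool k) → x ⊕ x ≡ zeroVec
⊕-self []          = refl
⊕-self (true  ∷ x) = cong (false ∷_) (⊕-self x)
⊕-self (false ∷ x) = cong (false ∷_) (⊕-self x)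

⊕≡0⇒≡ : (x y : Vec Bool k) → x ⊕ y ≡ zeroVec → x ≡ y
⊕≡0⇒≡ x y e = begin
  x              ≡⟨ ⊕-identityʳ x ⟨
  x ⊕ zeroVec    ≡⟨ cong (x ⊕_) (⊕-self y) ⟨
  x ⊕ (y ⊕ y)    ≡⟨ ⊕-assoc x y y ⟨
  (x ⊕ y) ⊕ y    ≡⟨ cong (_⊕ y) e ⟩
  zeroVec ⊕ y    ≡⟨ ⊕-identityˡ y ⟩
  y              ∎
  where open ≡-Reasoning

⊕-interchange : (a b c d : Vec Bool k) → (a ⊕ b) ⊕ (c ⊕ d) ≡ (a ⊕ c) ⊕ (b ⊕ d)
⊕-interchange a b c d = begin
  (a ⊕ b) ⊕ (c ⊕ d)   ≡⟨ ⊕-assoc a b (c ⊕ d) ⟩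
  a ⊕ (b ⊕ (c ⊕ d))   ≡⟨ cong (a ⊕_) (⊕-assoc b c d) ⟨
  a ⊕ ((b ⊕ c) ⊕ d)   ≡⟨ cong (λ z → a ⊕ (z ⊕ d)) (⊕-comm b c) ⟩
  a ⊕ ((c ⊕ b) ⊕ d)   ≡⟨ cong (a ⊕_) (⊕-assoc c b d) ⟩
  a ⊕ (c ⊕ (b ⊕ d))   ≡⟨ ⊕-assoc a c (b ⊕ d) ⟨
  (a ⊕ c) ⊕ (b ⊕ d)   ∎
  where open ≡-Reasoning

lookup≡false⇒∉ : (X : Subset m) {e : Fin m} → lookup X e ≡ false → e ∉ X
lookup≡false⇒∉ X eq e∈ with trans (sym eq) ([]=⇒lookup e∈)
... | ()

∉⇒lookup≡false : (X : Subset m) {e : Fin m} → e ∉ X → lookup X e ≡ false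
∉⇒lookup≡false X {e} e∉ with lookup X e in eq
... | true  = contradiction (lookup⇒[]= e X eq) e∉
... | false = refl

∈⊕⁻ : (X Y : Subset m) {e : Fin m} → e ∈ X ⊕ Y → (e ∈ X × e ∉ Y) ⊎ (e ∉ X × e ∈ Y)
∈⊕⁻ X Y {e} e∈ with lookup X e in p | lookup Y e in q | trans (sym (lookup-zipWith _xor_ e X Y)) ([]=⇒lookup e∈)
... | true  | false | _ = inj₁ (lookup⇒[]= e X p , lookup≡false⇒∉ Y q)
... | false | true  | _ = inj₂ (lookup≡false⇒∉ X p , lookup⇒[]= e Y q)

∈⊕⁺ : (X Y : Subset m) {e : Fin m} → e ∈ X → e ∉ Y → e ∈ X ⊕ Y
∈⊕⁺ X Y {e} e∈ e∉ = lookup⇒[]= e _ (trans (lookup-zipWith _xor_ e X Y) (cong₂ _xor_ ([]=⇒lookup e∈) (∉⇒lookup≡false Y e∉)))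

⊕-⊆ : {X Y S : Subset m} → X ⊆ S → Y ⊆ S → X ⊕ Y ⊆ S
⊕-⊆ {X = X} {Y} X⊆ Y⊆ e∈ with ∈⊕⁻ X Y e∈
... | inj₁ (e∈X , _) = X⊆ e∈X
... | inj₂ (_ , e∈Y) = Y⊆ e∈Y

⊕-nonempty : (X Y : Subset m) → X ≢ Y → Nonempty (X ⊕ Y)
⊕-nonempty X Y X≢Y with nonempty? (X ⊕ Y)
... | yes ne = ne
... | no  em = contradiction (⊕≡0⇒≡ X Y (Empty-unique em)) X≢Y

x∉p-x : (X : Subset m) (e : Fin m) → e ∉ X - e
x∉p-x (_ ∷ X) zero    ()
x∉p-x (_ ∷ X) (suc e) (there p) = x∉p-x X e p

greatest : (X : Subset m) → Nonempty X → ∃ λ e → e ∈ X × (∀ {e′} → e′ ∈ X → e′ ≤ᶠ e)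
greatest (b ∷ X) ne with nonempty? X
greatest (b ∷ X) ne | yes ne′ with greatest X ne′
... | e , e∈ , max = suc e , there e∈ , λ { {zero} _ → z≤n ; {suc _} (there p) → s≤s (max p) }
greatest (b ∷ X) (zero  , p)       | no em = zero , p , λ { {zero} _ → z≤n ; {suc _} (there q) → contradiction (_ , q) em }
greatest (b ∷ X) (suc _ , there p) | no em = contradiction (_ , p) em

nonempty⇒∣∣>0 : {X : Subset m} → Nonempty X → 0 < ∣ X ∣
nonempty⇒∣∣>0 (_ , e∈) = ≤-trans (s≤s z≤n) (x∈p⇒∣p-x∣<∣p∣ e∈)

sumF2-∅ : ∀ {d} (v : Fin m → Vec Bool d) → sumF2 v ∅ ≡ zeroVec
sumF2-∅ {zero}  v = refl
sumF2-∅ {suc m} v = sumF2-∅ (λ i → v (suc i))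

sumF2-⁅⁆ : ∀ {d} (v : Fin m → Vec Bool d) e → sumF2 v ⁅ e ⁆ ≡ v e
sumF2-⁅⁆ v zero    = trans (cong (v zero ⊕_) (sumF2-∅ (λ i → v (suc i)))) (⊕-identityʳ (v zero))
sumF2-⁅⁆ v (suc e) = sumF2-⁅⁆ (λ i → v (suc i)) e

-- Common elements of `X` and `Y` occur twice on the right and cancel in characteristic 2. Closure
-- of cycles under symmetric difference rests on this.
sumF2-⊕ : ∀ {d} (v : Fin m → Vec Bool d) X Y → sumF2 v (X ⊕ Y) ≡ sumF2 v X ⊕ sumF2 v Y
sumF2-⊕ {zero}  v []          []          = sym (⊕-self zeroVec)
sumF2-⊕ {suc m} v (true  ∷ X) (true  ∷ Y) = begin
  sumF2 v′ (X ⊕ Y)                              ≡⟨ sumF2-⊕ v′ X Y ⟩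
  sumF2 v′ X ⊕ sumF2 v′ Y                       ≡⟨ ⊕-identityˡ _ ⟨
  zeroVec ⊕ (sumF2 v′ X ⊕ sumF2 v′ Y)           ≡⟨ cong (_⊕ (sumF2 v′ X ⊕ sumF2 v′ Y)) (⊕-self (v zero)) ⟨
  (v zero ⊕ v zero) ⊕ (sumF2 v′ X ⊕ sumF2 v′ Y) ≡⟨ ⊕-interchange (v zero) (v zero) _ _ ⟩
  (v zero ⊕ sumF2 v′ X) ⊕ (v zero ⊕ sumF2 v′ Y) ∎
  where
  open ≡-Reasoning
  v′ = λ i → v (suc i)
sumF2-⊕ {suc m} v (true  ∷ X) (false ∷ Y) = trans (cong (v zero ⊕_) (sumF2-⊕ _ X Y)) (sym (⊕-assoc (v zero) _ _))
sumF2-⊕ {suc m} v (false ∷ X) (true  ∷ Y) = begin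
  v zero ⊕ sumF2 v′ (X ⊕ Y)              ≡⟨ cong (v zero ⊕_) (sumF2-⊕ v′ X Y) ⟩
  v zero ⊕ (sumF2 v′ X ⊕ sumF2 v′ Y)     ≡⟨ ⊕-assoc (v zero) _ _ ⟨
  (v zero ⊕ sumF2 v′ X) ⊕ sumF2 v′ Y     ≡⟨ cong (_⊕ sumF2 v′ Y) (⊕-comm (v zero) _) ⟩
  (sumF2 v′ X ⊕ v zero) ⊕ sumF2 v′ Y     ≡⟨ ⊕-assoc _ (v zero) _ ⟩
  sumF2 v′ X ⊕ (v zero ⊕ sumF2 v′ Y)     ∎
  where
  open ≡-Reasoning
  v′ = λ i → v (suc i)
sumF2-⊕ {suc m} v (false ∷ X) (false ∷ Y) = sumF2-⊕ _ X Y

-- Spans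

module Span {m d} (v : Fin m → Vec Bool d) where

  Span : Subset m → Vec Bool d → Set
  Span S x = ∃ λ X → X ⊆ S × sumF2 v X ≡ x

  span-⊕ : ∀ {S x y} → Span S x → Span S y → Span S (x ⊕ y)
  span-⊕ (X , X⊆ , refl) (Y , Y⊆ , refl) = X ⊕ Y , ⊕-⊆ X⊆ Y⊆ , sumF2-⊕ v X Y

  span-∈ : ∀ {S e} → e ∈ S → Span S (v e)
  span-∈ {S} {e} e∈ = ⁅ e ⁆ , (λ x∈ → subst (_∈ S) (sym (x∈⁅y⁆⇒x≡y e x∈)) e∈) , sumF2-⁅⁆ v e

  span-sum : ∀ {S k} (w : Fin k → Vec Bool d) X → (∀ {e} → e ∈ X → Span S (w e)) → Span S (sumF2 w X)
  span-sum {k = zero}  w []          h = ∅ , (λ x∈ → ⊥-elim (∉⊥ x∈)) , sumF2-∅ v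
  span-sum {k = suc k} w (true  ∷ X) h = span-⊕ (h here) (span-sum _ X (λ e∈ → h (there e∈)))
  span-sum {k = suc k} w (false ∷ X) h = span-sum _ X (λ e∈ → h (there e∈))

-- Cycles and circuits of a binary matroid

module Cycles {m d} (M : Matroid m) (v : Fin m → Vec Bool d)
  (rep : ∀ S → (indep M S ≡ true → LinIndepF2 v S) × (LinIndepF2 v S → indep M S ≡ true)) where

  open Span v public

  -- The nonzero elements of the cycle space supported in `S`. Unlike circuits, they are closed
  -- under symmetric difference of distinct members.
  CycleIn : Subset m → Subset m → Set
  CycleIn S Z = Z ⊆ S × Nonempty Z × sumF2 v Z ≡ zeroVec

  cycleIn? : ∀ S Z → Dec (CycleIn S Z)
  cycleIn? S Z = (Z ⊆? S) ×-dec (nonempty? Z ×-dec (≡-dec _≟ᵇ_ (sumF2 v Z) zeroVec))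

  cycle-mono : ∀ {S S′ Z} → S ⊆ S′ → CycleIn S Z → CycleIn S′ Z
  cycle-mono S⊆ (Z⊆ , cyc) = (λ e∈ → S⊆ (Z⊆ e∈)) , cyc

  cycle-⊕ : ∀ {S X Y} → X ≢ Y → CycleIn S X → CycleIn S Y → CycleIn S (X ⊕ Y)
  cycle-⊕ {X = X} {Y} X≢Y (X⊆ , _ , zX) (Y⊆ , _ , zY) =
    ⊕-⊆ X⊆ Y⊆ , ⊕-nonempty X Y X≢Y , trans (sumF2-⊕ v X Y) (trans (cong₂ _⊕_ zX zY) (⊕-self zeroVec))

  cycle⇒dependent : ∀ {S Z} → CycleIn S Z → indep M S ≡ false
  cycle⇒dependent {S} {Z} (Z⊆ , ne , z) with indep M S in eq
  ... | false = refl
  ... | true  = contradiction z (proj₁ (rep S) eq Z Z⊆ ne)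

  dependent⇒cycle : ∀ {S} → indep M S ≡ false → ∃ (CycleIn S)
  dependent⇒cycle {S} dep with anySubset? (cycleIn? S)
  ... | yes c = c
  ... | no ¬c with trans (sym dep) (proj₂ (rep S) (λ Z Z⊆ ne z → ¬c (Z , Z⊆ , ne , z)))
  ...   | ()

  -- Length at most 3/2 of the girth of `S`, expressed without naming the girth.
  Short : Subset m → Subset m → Set
  Short S C = CycleIn S C × ¬ ∃ λ Z → CycleIn S Z × 3 * ∣ Z ∣ < 2 * ∣ C ∣

  short? : ∀ S C → Dec (Short S C)
  short? S C = cycleIn? S C ×-dec ¬? (anySubset? (λ Z → cycleIn? S Z ×-dec (3 * ∣ Z ∣ <? 2 * ∣ C ∣)))

  shortest-cycle : ∀ {S Z} → CycleIn S Z → ∃ λ C → CycleIn S C × (∀ {Z} → CycleIn S Z → ∣ C ∣ ≤ ∣ Z ∣)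
  shortest-cycle {S} {Z} cyc = go Z cyc (<-wellFounded ∣ Z ∣)
    where
    go : ∀ Z → CycleIn S Z → Acc _<_ ∣ Z ∣ → ∃ λ C → CycleIn S C × (∀ {Z} → CycleIn S Z → ∣ C ∣ ≤ ∣ Z ∣)
    go Z cyc (acc rec) with anySubset? (λ X → cycleIn? S X ×-dec (∣ X ∣ <? ∣ Z ∣))
    ... | yes (X , cycX , X<Z) = go X cycX (rec X<Z)
    ... | no  none             = Z , cyc , λ {X} cycX → ≮⇒≥ (λ X<Z → none (X , cycX , X<Z))

  -- A dependent proper subset of `C` would contain a cycle shorter than `C`.
  shortest⇒circuit : ∀ {S C} → CycleIn S C → (∀ {Z} → CycleIn S Z → ∣ C ∣ ≤ ∣ Z ∣) → IsCircuit M C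
  shortest⇒circuit {S} {C} (C⊆ , cyc) min = cycle⇒dependent (⊆-refl , cyc) , proper
    where
    proper : ∀ X → X ⊂ C → indep M X ≡ true
    proper X X⊂C with indep M X in eq
    ... | true  = refl
    ... | false with dependent⇒cycle eq
    ...   | Z , Z⊆X , cycZ = ⊥-elim (<⇒≱ (≤-<-trans (p⊆q⇒∣p∣≤∣q∣ Z⊆X) (p⊂q⇒∣p∣<∣q∣ X⊂C))
              (min ((λ e∈ → C⊆ (proj₁ X⊂C (Z⊆X e∈))) , cycZ)))

  cycle⇒circuit : ∀ {S Z} → CycleIn S Z → ∃ (IsCircuitIn M S)
  cycle⇒circuit cyc with shortest-cycle cyc
  ... | C , cycC , min = C , proj₁ cycC , shortest⇒circuit cycC min

  -- Being dependent, `C` contains a cycle; as proper subsets of `C` are independent, this cycle is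
  -- all of `C`.
  circuit⇒cycle : ∀ {S C} → IsCircuitIn M S C → CycleIn S C
  circuit⇒cycle {S} {C} (C⊆ , dep , proper) with dependent⇒cycle dep
  ... | Z , cycZ@(Z⊆ , cyc) with Z ⊂? C
  ...   | no  Z⊄C = C⊆ , subst (λ X → Nonempty X × sumF2 v X ≡ zeroVec) (⊆-antisym Z⊆ C⊆Z) cyc
    where
    C⊆Z : C ⊆ Z
    C⊆Z {e} e∈ with e ∈? Z
    ... | yes e∈Z = e∈Z
    ... | no  e∉Z = ⊥-elim (Z⊄C (Z⊆ , e , e∈ , e∉Z))
  ...   | yes Z⊂C with trans (sym (proper Z Z⊂C)) (cycle⇒dependent (⊆-refl , cyc))
  ...     | ()

  isCircuitIn? : ∀ S C → Dec (IsCircuitIn M S C)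
  isCircuitIn? S C with C ⊆? S | indep M C ≟ᵇ false | anySubset? (λ X → (X ⊂? C) ×-dec (indep M X ≟ᵇ false))
  ... | no ¬C⊆ | _      | _                 = no λ c → ¬C⊆ (proj₁ c)
  ... | yes _  | no ¬d  | _                 = no λ c → ¬d (proj₁ (proj₂ c))
  ... | yes _  | yes _  | yes (X , X⊂C , d) = no λ c → contradiction (trans (sym d) (proj₂ (proj₂ c) X X⊂C)) λ ()
  ... | yes C⊆ | yes d  | no none           = yes (C⊆ , d , proper)
    where
    proper : ∀ X → X ⊂ C → indep M X ≡ true
    proper X X⊂C with indep M X in eq
    ... | true  = refl
    ... | false = contradiction (X , X⊂C , eq) none

  -- Deleting greatest elements of unique cycles

  -- Says, in terms of the oracle only, that Y contains a unique cycle and that e is its greatest element.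
  Top : Subset m → Fin m → Set
  Top Y e = e ∈ Y × indep M Y ≡ false × indep M (Y - e) ≡ true × (∀ e′ → e′ ∈ Y → e <ᶠ e′ → indep M (Y - e′) ≡ false)

  -- Independence of `Y - e` puts `e` into every cycle of `Y`. Were some `e′` in `Z` greater than
  -- `e`, dependence of `Y - e′` would give a second cycle.
  top⇒cycle : ∀ {Y e} → Top Y e → ∃ λ Z → CycleIn Y Z × e ∈ Z × (∀ {e′} → e′ ∈ Z → e′ ≤ᶠ e)
  top⇒cycle {Y} {e} (e∈Y , dep , ind , above) with dependent⇒cycle dep
  ... | Z , cycZ = Z , cycZ , e∈cycle cycZ , λ {e′} e′∈Z → ≮⇒≥ (λ e<e′ → no-above e′ e<e′ e′∈Z)
    where
    e∈cycle : ∀ {X} → CycleIn Y X → e ∈ X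
    e∈cycle {X} (X⊆ , cyc) with e ∈? X
    ... | yes e∈ = e∈
    ... | no  e∉ = contradiction (trans (sym ind) (cycle⇒dependent ((λ {x} x∈ → x∈p∧x≢y⇒x∈p-y (X⊆ x∈) (λ { refl → e∉ x∈ })) , cyc))) λ ()
    no-above : ∀ e′ → e <ᶠ e′ → e′ ∉ Z
    no-above e′ e<e′ e′∈Z with dependent⇒cycle (above e′ (proj₁ cycZ e′∈Z) e<e′)
    -- Both cycles contain `e`, so their symmetric difference is a cycle without `e`, which is
    -- impossible.
    ... | X , X⊆ , cycX with ∈⊕⁻ Z X (e∈cycle (cycle-⊕ Z≢X cycZ cycX′))
      where
      cycX′ : CycleIn Y X
      cycX′ = (λ x∈ → p─q⊆p Y ⁅ e′ ⁆ (X⊆ x∈)) , cycX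
      Z≢X : Z ≢ X
      Z≢X refl = x∉p-x Y e′ (X⊆ e′∈Z)
    ...   | inj₁ (_ , e∉X) = e∉X (e∈cycle ((λ x∈ → p─q⊆p Y ⁅ e′ ⁆ (X⊆ x∈)) , cycX))
    ...   | inj₂ (e∉Z , _) = e∉Z (e∈cycle cycZ)

  -- By induction on e: a cycle with greatest element e expresses v e through smaller elements.
  span-deletion : ∀ {S S′} → (∀ {e} → e ∈ S → e ∉ S′ → ∃ λ Y → Y ⊆ S × Top Y e) →
                  ∀ {x} → Span S x → Span S′ x
  span-deletion {S} {S′} deleted (X , X⊆ , refl) = span-sum v X (λ {e} e∈ → go e (X⊆ e∈) (<ᶠ-wellFounded e))
    where
    go : ∀ e → e ∈ S → Acc _<ᶠ_ e → Span S′ (v e)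
    go e e∈S (acc rec) with e ∈? S′
    ... | yes e∈S′ = span-∈ e∈S′
    ... | no  e∉S′ with deleted e∈S e∉S′
    ...   | Y , Y⊆S , top with top⇒cycle top
    ...     | Z , (Z⊆Y , _ , z) , e∈Z , max = subst (Span S′) sum≡ (span-sum v (Z ⊕ ⁅ e ⁆) smaller)
      where
      sum≡ : sumF2 v (Z ⊕ ⁅ e ⁆) ≡ v e
      sum≡ = trans (sumF2-⊕ v Z ⁅ e ⁆) (trans (cong₂ _⊕_ z (sumF2-⁅⁆ v e)) (⊕-identityˡ (v e)))
      smaller : ∀ {x} → x ∈ Z ⊕ ⁅ e ⁆ → Span S′ (v x)
      smaller {x} x∈ with ∈⊕⁻ Z ⁅ e ⁆ x∈
      ... | inj₁ (x∈Z , x∉e) = go x (Y⊆S (Z⊆Y x∈Z)) (rec (≤∧≢⇒< (max x∈Z) (λ eq → x∉e (subst (_∈ ⁅ e ⁆) (toℕ-injective (sym eq)) (x∈⁅x⁆ e)))))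
      ... | inj₂ (x∉Z , x∈e) = contradiction (subst (_∈ Z) (sym (x∈⁅y⁆⇒x≡y e x∈e)) e∈Z) x∉Z

  -- Y isolates C when C is the only cycle in Y.
  Isolates : Subset m → Subset m → Set
  Isolates Y C = C ⊆ Y × (∀ e → e ∈ C → indep M (Y - e) ≡ true)

  -- The witness is the greatest element of `C`; deleting anything greater leaves `C` intact, hence
  -- a dependent set.
  isolated⇒top : ∀ {Y C} → Nonempty C → sumF2 v C ≡ zeroVec → Isolates Y C → ∃ λ e → e ∈ C × Top Y e
  isolated⇒top {Y} {C} ne z (C⊆Y , ind) with greatest C ne
  ... | e , e∈C , max = e , e∈C , C⊆Y e∈C , cycle⇒dependent (C⊆Y , ne , z) , ind e e∈C ,
        λ e′ _ e<e′ → cycle⇒dependent {Z = C} ((λ {x} x∈ → x∈p∧x≢y⇒x∈p-y (C⊆Y x∈) (λ { refl → <⇒≱ e<e′ (max x∈) })) , ne , z)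

  isolates? : ∀ Y C → Dec (Isolates Y C)
  isolates? Y C with C ⊆? Y | all? (λ e → (e ∈? C) →-dec (indep M (Y - e) ≟ᵇ true))
  ... | yes C⊆ | yes ind = yes (C⊆ , ind)
  ... | yes _  | no ¬ind = no λ iso → ¬ind (proj₂ iso)
  ... | no ¬C⊆ | _       = no λ iso → ¬C⊆ (proj₁ iso)

  -- Some `Y - e` with `e ∈ C` is dependent, and a circuit inside it misses `e`, so it differs from
  -- `C`.
  ¬isolated⇒circuit : ∀ {S C Y} → C ⊆ Y → Y ⊆ S → ¬ Isolates Y C → ∃ λ C′ → IsCircuitIn M S C′ × C′ ≢ C × C′ ⊆ Y
  ¬isolated⇒circuit {S} {C} {Y} C⊆Y Y⊆S ¬iso with any? (λ e → (e ∈? C) ×-dec (indep M (Y - e) ≟ᵇ false))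
  ... | no none = ⊥-elim (¬iso (C⊆Y , ind))
    where
    ind : ∀ e → e ∈ C → indep M (Y - e) ≡ true
    ind e e∈ with indep M (Y - e) in eq
    ... | true  = refl
    ... | false = contradiction (e , e∈ , eq) none
  ... | yes (e , e∈C , dep) with cycle⇒circuit (proj₂ (dependent⇒cycle dep))
  ...   | C′ , C′⊆ , circ = C′ , ((λ x∈ → Y⊆S (C′⊆Y x∈)) , circ) , (λ { refl → x∉p-x Y e (C′⊆ e∈C) }) , C′⊆Y
    where
    C′⊆Y : C′ ⊆ Y
    C′⊆Y x∈ = p─q⊆p Y ⁅ e ⁆ (C′⊆ x∈)

  -- For maximality, an element `e` outside `S` together with a subset `X` of `S` summing to `v e`
  -- forms a cycle.
  acyclic-spanning⇒basis : ∀ {S} → (∀ {Z} → ¬ CycleIn S Z) → (∀ e → Span S (v e)) → IsBasis M S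
  acyclic-spanning⇒basis {S} acyclic spanning = independent , maximal
    where
    independent : indep M S ≡ true
    independent with indep M S in eq
    ... | true  = refl
    ... | false = ⊥-elim (acyclic (proj₂ (dependent⇒cycle eq)))
    maximal : ∀ A → S ⊂ A → indep M A ≡ false
    maximal A (S⊆A , e , e∈A , e∉S) with spanning e
    ... | X , X⊆S , sum≡ = cycle⇒dependent {Z = ⁅ e ⁆ ⊕ X}
          ( ⊕-⊆ (λ x∈ → subst (_∈ A) (sym (x∈⁅y⁆⇒x≡y e x∈)) e∈A) (λ x∈ → S⊆A (X⊆S x∈))
          , (e , ∈⊕⁺ ⁅ e ⁆ X (x∈⁅x⁆ e) (λ e∈ → e∉S (X⊆S e∈)))
          , trans (sumF2-⊕ v ⁅ e ⁆ X) (trans (cong₂ _⊕_ (sumF2-⁅⁆ v e) sum≡) (⊕-self (v e))) )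

-- Subsets given by decidable predicates

select : ∀ {m} {P : Fin m → Set} → Decidable P → Subset m
select P? = tabulate (does ∘ P?)

∈select⁻ : ∀ {m} {P : Fin m → Set} (P? : Decidable P) {e} → e ∈ select P? → P e
∈select⁻ P? {e} e∈ with P? e | trans (sym (lookup∘tabulate (does ∘ P?) e)) ([]=⇒lookup e∈)
... | yes p | _ = p

∈select⁺ : ∀ {m} {P : Fin m → Set} (P? : Decidable P) {e} → P e → e ∈ select P?
∈select⁺ P? {e} p = lookup⇒[]= e _ (trans (lookup∘tabulate (does ∘ P?) e) does≡true)
  where
  does≡true : does (P? e) ≡ true
  does≡true with P? e
  ... | yes _ = refl
  ... | no ¬p = contradiction p ¬p

-- The algorithm, for given test sets T j

module Algorithm {m J : ℕ} (T : Fin J → Subset m) where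

  -- Index `zero` queries the whole set and the others its single deletions: exactly the oracle
  -- values that `Top` refers to.
  probe : Subset m → Fin (suc m) → Subset m
  probe Y zero    = Y
  probe Y (suc e) = Y - e

  queries : Subset m → Fin (J * suc m) → Subset m
  queries S = uncurry (λ j → probe (S ∩ T j)) ∘ remQuot (suc m)

  -- `Top (S ∩ T j) e` for some `j`, read off from the recorded answers alone, since the algorithm
  -- sees nothing else of the matroid.
  Deleted : Subset m → (Fin (J * suc m) → Bool) → Fin m → Set
  Deleted S ans e = ∃ λ j → e ∈ S ∩ T j × ans (combine j zero) ≡ false × ans (combine j (suc e)) ≡ true ×
    (∀ e′ → e′ ∈ S ∩ T j → e <ᶠ e′ → ans (combine j (suc e′)) ≡ false)

  deleted? : ∀ S ans → Decidable (Deleted S ans)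
  deleted? S ans e = any? λ j →
    (e ∈? (S ∩ T j)) ×-dec ((ans (combine j zero) ≟ᵇ false) ×-dec ((ans (combine j (suc e)) ≟ᵇ true) ×-dec
    all? λ e′ → (e′ ∈? (S ∩ T j)) →-dec ((e <ᶠ? e′) →-dec (ans (combine j (suc e′)) ≟ᵇ false))))

  kept? : ∀ S ans → Decidable (λ e → e ∈ S × ¬ Deleted S ans e)
  kept? S ans e = (e ∈? S) ×-dec ¬? (deleted? S ans e)

  next : Subset m → (Fin (J * suc m) → Bool) → Subset m
  next S ans = select (kept? S ans)

  strategy : ∀ R → Subset m → Strategy m (J * suc m) R
  strategy zero    S = done S
  strategy (suc R) S = ask (queries S) (λ ans → strategy R (next S ans))

  module Correctness {d} (M : Matroid m) (v : Fin m → Vec Bool d)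
    (rep : ∀ S → (indep M S ≡ true → LinIndepF2 v S) × (LinIndepF2 v S → indep M S ≡ true)) where

    open Cycles M v rep

    answers : Subset m → Fin (J * suc m) → Bool
    answers S i = indep M (queries S i)

    answers-combine : ∀ S j k → answers S (combine j k) ≡ indep M (probe (S ∩ T j) k)
    answers-combine S j k = cong (λ p → indep M (uncurry (λ j → probe (S ∩ T j)) p)) (remQuot-combine j k)

    deleted⇒top : ∀ S {e} → Deleted S (answers S) e → ∃ λ j → Top (S ∩ T j) e
    deleted⇒top S {e} (j , e∈ , dep , ind , above) = j , e∈ ,
      trans (sym (answers-combine S j zero)) dep , trans (sym (answers-combine S j (suc e))) ind ,
      λ e′ e′∈ lt → trans (sym (answers-combine S j (suc e′))) (above e′ e′∈ lt)

    top⇒deleted : ∀ S {e} j → Top (S ∩ T j) e → Deleted S (answers S) e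
    top⇒deleted S {e} j (e∈ , dep , ind , above) = j , e∈ ,
      trans (answers-combine S j zero) dep , trans (answers-combine S j (suc e)) ind ,
      λ e′ e′∈ lt → trans (answers-combine S j (suc e′)) (above e′ e′∈ lt)

    -- The good event. It concerns all `S` at once because all rounds reuse the same tests, so the
    -- sets reached depend on the randomness.
    Covers : Set
    Covers = ∀ S C → Short S C → ∃ λ j → Isolates (S ∩ T j) C

    -- If `S` had no such `Z₀`, then `Z` would be short in `S`, some test would isolate it, and its
    -- greatest element would have been deleted.
    survivor : Covers → ∀ {S Z} → CycleIn (next S (answers S)) Z → ∃ λ Z₀ → CycleIn S Z₀ × 3 * ∣ Z₀ ∣ < 2 * ∣ Z ∣
    survivor covers {S} {Z} cyc@(Z⊆ , ne , z) with anySubset? (λ X → cycleIn? S X ×-dec (3 * ∣ X ∣ <? 2 * ∣ Z ∣))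
    ... | yes shorter = shorter
    ... | no  none with covers S Z (cycle-mono (λ e∈ → proj₁ (∈select⁻ (kept? S (answers S)) e∈)) cyc , none)
    ...   | j , iso with isolated⇒top ne z iso
    ...     | e , e∈Z , top = ⊥-elim (proj₂ (∈select⁻ (kept? S (answers S)) (Z⊆ e∈Z)) (top⇒deleted S j top))

    next-span : ∀ S {x} → Span S x → Span (next S (answers S)) x
    next-span S = span-deletion λ {e} e∈ e∉ → deleted e e∈ e∉
      where
      deleted : ∀ e → e ∈ S → e ∉ next S (answers S) → ∃ λ Y → Y ⊆ S × Top Y e
      deleted e e∈ e∉ with deleted? S (answers S) e
      ... | no ¬del = contradiction (∈select⁺ (kept? S (answers S)) (e∈ , ¬del)) e∉
      ... | yes del with deleted⇒top S del
      ...   | j , top = S ∩ T j , p∩q⊆p S (T j) , top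

    -- After i rounds every cycle has length at least (3/2) ^ i.
    run-basis : Covers → ∀ R i S → (∀ e → Span S (v e)) → (∀ {Z} → CycleIn S Z → 3 ^ i ≤ 2 ^ i * ∣ Z ∣) →
                2 ^ (R + i) * m < 3 ^ (R + i) → IsBasis M (run (indep M) (strategy R S))
    run-basis covers zero i S spanning long large =
      acyclic-spanning⇒basis (λ {Z} cyc → <⇒≱ large (≤-trans (long cyc) (*-monoʳ-≤ (2 ^ i) (∣p∣≤n Z)))) spanning
    run-basis covers (suc R) i S spanning long large =
      run-basis covers R (suc i) (next S (answers S)) (λ e → next-span S (spanning e)) longer
        (subst (λ k → 2 ^ k * m < 3 ^ k) (sym (+-suc R i)) large)
      where
      open ≤-Reasoning
      r : ∀ p z → p * (2 * z) ≡ 2 * p * z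
      r = solve-∀
      r′ : ∀ p z → 3 * (p * z) ≡ p * (3 * z)
      r′ = solve-∀
      longer : ∀ {Z} → CycleIn (next S (answers S)) Z → 3 ^ suc i ≤ 2 ^ suc i * ∣ Z ∣
      longer {Z} cyc with survivor covers cyc
      ... | Z₀ , cyc₀ , 3Z₀<2Z = begin
        3 * 3 ^ i                ≤⟨ *-monoʳ-≤ 3 (long cyc₀) ⟩
        3 * (2 ^ i * ∣ Z₀ ∣)     ≡⟨ r′ (2 ^ i) ∣ Z₀ ∣ ⟩
        2 ^ i * (3 * ∣ Z₀ ∣)     ≤⟨ *-monoʳ-≤ (2 ^ i) (<⇒≤ 3Z₀<2Z) ⟩
        2 ^ i * (2 * ∣ Z ∣)      ≡⟨ r (2 ^ i) ∣ Z ∣ ⟩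
        2 * 2 ^ i * ∣ Z ∣        ∎

    -- After `2 * L` rounds a cycle would need at least `(9 / 4) ^ L ≥ 2 ^ L > m` elements.
    -- Initially every cycle has at least one.
    finds-basis : Covers → IsBasis M (run (indep M) (strategy (2 * (⌊log₂ m ⌋ + 1)) ⊤))
    finds-basis covers = run-basis covers (2 * L) 0 ⊤ (λ e → span-∈ ∈⊤)
      (λ { {Z} (_ , ne , _) → ≤-trans (nonempty⇒∣∣>0 ne) (≤-reflexive (sym (+-identityʳ ∣ Z ∣))) }) (begin-strict
        2 ^ (2 * L + 0) * m     ≡⟨ cong (λ k → 2 ^ k * m) (+-identityʳ (2 * L)) ⟩
        2 ^ (2 * L) * m         ≡⟨ cong (_* m) (^-*-assoc 2 2 L) ⟨
        4 ^ L * m               <⟨ *-monoʳ-< (4 ^ L) {{m^n≢0 4 L}} (subst (λ k → m < 2 ^ k) (+-comm 1 ⌊log₂ m ⌋) (m<2^[log₂m+1] m)) ⟩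
        4 ^ L * 2 ^ L           ≡⟨ ^-distribʳ-* 4 2 L ⟨
        8 ^ L                   ≤⟨ ^-monoˡ-≤ L (n≤1+n 8) ⟩
        9 ^ L                   ≡⟨ ^-*-assoc 3 2 L ⟩
        3 ^ (2 * L)             ≡⟨ cong (3 ^_) (+-identityʳ (2 * L)) ⟨
        3 ^ (2 * L + 0)         ∎)
      where
      open ≤-Reasoning
      L = ⌊log₂ m ⌋ + 1

-- Probability that one sample isolates a short cycle

open Probability

-- A set of ℓ elements (ℓ the girth) is sampled with probability about n ^ (- decay K). The factor 8 is that of layer-difference;
-- the counting bound consumes K, and 2 is left for the union over the layers.
decay : ℕ → ℕ
decay K = 8 * (K + 2)

-- The reciprocal of a lower bound for the probability that one sample isolates a given short cycle.
rarity : ℕ → ℕ → ℕ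
rarity K n = n * (n ^ suc (decay K)) ^ 2

-- The union bound is over 4 ^ m pairs (S , C), and the target 1 / m costs another factor m ≤ 2 ^ m.
sampleCount : ℕ → ℕ → ℕ → ℕ
sampleCount K m n = rarity K n * (3 * m)

module Sampling {m d} (M : Matroid m) (v : Fin m → Vec Bool d)
  (rep : ∀ S → (indep M S ≡ true → LinIndepF2 v S) × (LinIndepF2 v S → indep M S ≡ true))
  (K : ℕ) (smooth : SmoothCircuitBound M K) (n B : ℕ) (2+m≤n : 2 + m ≤ n)
  (prob : ∀ (i : Fin m) → Probability n (decay K) (2 ^ B) (suc (toℕ i))) where

  open Cycles M v rep

  instance
    n≢0 : NonZero n
    n≢0 = >-nonZero (≤-trans (s≤s z≤n) 2+m≤n)
    2^B≢0 : NonZero (2 ^ B)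
    2^B≢0 = m^n≢0 2 B

  module _ {S C : Subset m} (cycC : CycleIn S C) {ℓ} .{{_ : NonZero ℓ}} (min : MinCircuitLength M S ℓ)
           (girth : ∀ {Z} → CycleIn S Z → ℓ ≤ ∣ Z ∣) (2C≤3ℓ : 2 * ∣ C ∣ ≤ 3 * ℓ)
           (p : Probability n (decay K) (2 ^ B) ℓ) where

    D a W : ℕ
    D = 2 ^ B
    a = num p
    W = weight D a C

    isolatesAt? : ∀ (x : Vec Bool (m * B)) → Dec (Isolates (S ∩ sample a x) C)
    isolatesAt? x = isolates? (S ∩ sample a x) C

    Rival : Subset m → Set
    Rival C′ = IsCircuitIn M S C′ × C′ ≢ C

    rival? : ∀ C′ → Dec (Rival C′)
    rival? C′ = isCircuitIn? S C′ ×-dec ¬? (≡-dec _≟ᵇ_ C′ C)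

    -- Neighbouring layers share the length `suc α * ℓ`; double counting there only enlarges the
    -- upper bound.
    Layer : ℕ → Subset m → Set
    Layer α C′ = Rival C′ × α * ℓ ≤ ∣ C′ ∣ × ∣ C′ ∣ ≤ suc α * ℓ

    layer? : ∀ α C′ → Dec (Layer α C′)
    layer? α C′ = rival? C′ ×-dec ((α * ℓ ≤? ∣ C′ ∣) ×-dec (∣ C′ ∣ ≤? suc α * ℓ))

    -- Representability over F₂ enters here: C ⊕ C′ is a cycle, so it has at least ℓ elements.
    layer-difference : ∀ α C′ → Layer α C′ → suc α * ℓ ≤ 8 * ∣ C′ ─ C ∣
    layer-difference α C′ ((circ , C′≢C) , αℓ≤z , _) = ≤-trans (+-mono-≤ (girth cycC′) αℓ≤z)
      -- In effect `8 * j = 4 * x + 4 * z - 4 * c ≥ 4 * ℓ + 4 * z - 6 * ℓ ≥ 2 * z`, using `x ≥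
      -- ℓ`, `2 * c ≤ 3 * ℓ` and `z ≥ ℓ`.
      (+-cancelʳ-≤ (2 * (2 * c)) (z + z) (8 * j) (begin
        z + z + 2 * (2 * c)       ≤⟨ +-monoʳ-≤ (z + z) (*-monoʳ-≤ 2 2C≤3ℓ) ⟩
        z + z + 2 * (3 * ℓ)       ≡⟨ r₁ z ℓ ⟩
        4 * ℓ + 2 * (z + ℓ)       ≤⟨ +-mono-≤ (*-monoʳ-≤ 4 (girth (cycle-⊕ (λ e → C′≢C (sym e)) cycC cycC′)))
                                              (*-monoʳ-≤ 2 (+-monoʳ-≤ z (girth cycC′))) ⟩
        4 * x + 2 * (z + z)       ≡⟨ r₂ x z ⟩
        4 * (x + z)               ≡⟨ cong (4 *_) (∣⊕∣ C C′) ⟩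
        4 * (c + 2 * j)           ≡⟨ r₃ c j ⟩
        8 * j + 2 * (2 * c)       ∎))
      where
      open ≤-Reasoning
      c z j x : ℕ
      c = ∣ C ∣
      z = ∣ C′ ∣
      j = ∣ C′ ─ C ∣
      x = ∣ C ⊕ C′ ∣
      cycC′ = circuit⇒cycle circ
      r₁ : ∀ z ℓ → z + z + 2 * (3 * ℓ) ≡ 4 * ℓ + 2 * (z + ℓ)
      r₁ = solve-∀
      r₂ : ∀ x z → 4 * x + 2 * (z + z) ≡ 4 * (x + z)
      r₂ = solve-∀
      r₃ : ∀ c j → 4 * (c + 2 * j) ≡ 8 * j + 2 * (2 * c)
      r₃ = solve-∀

    -- By `weight-∪` only the elements of `C′ ─ C` matter once `C` is sampled, and
    -- `layer-difference` provides enough of them for `power-upper`.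
    layer-weight : ∀ α C′ → Layer α C′ → weight D a (C ∪ C′) * n ^ ((K + 2) * suc α) ≤ W
    layer-weight α C′ layer = *-cancelʳ-≤ _ _ (D ^ j) {{m^n≢0 D j}} (begin
      weight D a (C ∪ C′) * P * D ^ j     ≡⟨ r (weight D a (C ∪ C′)) P (D ^ j) ⟩
      weight D a (C ∪ C′) * D ^ j * P     ≡⟨ cong (_* P) (weight-∪ D a C C′) ⟩
      W * a ^ j * P                       ≡⟨ *-assoc W (a ^ j) P ⟩
      W * (a ^ j * P)                     ≤⟨ *-monoʳ-≤ W (power-upper {κ = K + 2} {ℓ = ℓ} (num-upper p) j (suc α) (layer-difference α C′ layer)) ⟩
      W * D ^ j                           ∎)
      where
      open ≤-Reasoning
      j P : ℕ
      j = ∣ C′ ─ C ∣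
      P = n ^ ((K + 2) * suc α)
      r : ∀ w p d → w * p * d ≡ w * d * p
      r = solve-∀

    layer-count : ∀ α → ∑ (λ C′ → ⟦ layer? α C′ ⟧) ≤ n ^ (K * suc α)
    layer-count α = begin
      ∑ (λ C′ → ⟦ layer? α C′ ⟧)                ≡⟨ length-filter-words (layer? α) ⟨
      length (filter (layer? α) (words m))      ≤⟨ smooth S ℓ min (suc α) (s≤s z≤n) _ (Unique.filter⁺ (layer? α) (words-unique m)) circuits ⟩
      m ^ (K * suc α)                           ≤⟨ ^-monoˡ-≤ (K * suc α) (≤-trans (m≤n+m m 2) 2+m≤n) ⟩
      n ^ (K * suc α)                           ∎
      where
      open ≤-Reasoning
      circuits : ∀ {C′} → C′ ∈ˡ filter (layer? α) (words m) → IsCircuitIn M S C′ × ∣ C′ ∣ ≤ suc α * ℓ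
      circuits C′∈ with proj₂ (∈-filter⁻ (layer? α) {xs = words m} C′∈)
      ... | (circ , _) , _ , C′≤ = circ , C′≤

    -- At most `n ^ (K * suc α)` circuits, each of weight at most `W / n ^ ((K + 2) * suc α)`, leave
    -- a spare factor `n ^ (2 * suc α) ≥ n ^ 2`.
    layer-sum : ∀ α → ∑ (λ C′ → ⟦ layer? α C′ ⟧ * weight D a (C ∪ C′)) * n ^ 2 ≤ W
    layer-sum α = *-cancelʳ-≤ _ _ (n ^ (K * suc α)) {{m^n≢0 n (K * suc α)}} (begin
      X * n ^ 2 * n ^ (K * suc α)                 ≤⟨ *-monoˡ-≤ (n ^ (K * suc α)) (*-monoʳ-≤ X (^-monoʳ-≤ n (m≤m*n 2 (suc α)))) ⟩
      X * n ^ (2 * suc α) * n ^ (K * suc α)       ≡⟨ *-assoc X _ _ ⟩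
      X * (n ^ (2 * suc α) * n ^ (K * suc α))     ≡⟨ cong (X *_) (^-distribˡ-+-* n (2 * suc α) (K * suc α)) ⟨
      X * n ^ (2 * suc α + K * suc α)             ≡⟨ cong (λ e → X * n ^ e) (r K α) ⟩
      X * P                                       ≡⟨ ∑-*ʳ P (λ C′ → ⟦ layer? α C′ ⟧ * weight D a (C ∪ C′)) ⟨
      ∑ (λ C′ → ⟦ layer? α C′ ⟧ * weight D a (C ∪ C′) * P) ≤⟨ ∑-mono term ⟩
      ∑ (λ C′ → ⟦ layer? α C′ ⟧ * W)              ≡⟨ ∑-*ʳ W (λ C′ → ⟦ layer? α C′ ⟧) ⟩
      ∑ (λ C′ → ⟦ layer? α C′ ⟧) * W              ≤⟨ *-monoˡ-≤ W (layer-count α) ⟩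
      n ^ (K * suc α) * W                         ≡⟨ *-comm (n ^ (K * suc α)) W ⟩
      W * n ^ (K * suc α)                         ∎)
      where
      open ≤-Reasoning
      X P : ℕ
      X = ∑ (λ C′ → ⟦ layer? α C′ ⟧ * weight D a (C ∪ C′))
      P = n ^ ((K + 2) * suc α)
      r : ∀ K α → 2 * suc α + K * suc α ≡ (K + 2) * suc α
      r = solve-∀
      term : ∀ C′ → ⟦ layer? α C′ ⟧ * weight D a (C ∪ C′) * P ≤ ⟦ layer? α C′ ⟧ * W
      term C′ with layer? α C′
      ... | no  _     = z≤n
      ... | yes layer = ≤-trans (≤-reflexive (cong (_* P) (+-identityʳ (weight D a (C ∪ C′)))))
                          (≤-trans (layer-weight α C′ layer) (≤-reflexive (sym (+-identityʳ W))))

    -- A rival lies in the layer `∣ C′ ∣ / ℓ`, rounded down, which is at most `m`.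
    rival-layers : ∀ C′ → ⟦ rival? C′ ⟧ ≤ ∑< (suc m) (λ α → ⟦ layer? α C′ ⟧)
    rival-layers C′ = ⟦⟧≤ (rival? C′) λ rival →
      ≤-trans (≤-reflexive (sym (⟦yes⟧ (layer? α C′) (rival , lower , upper))))
        (term≤∑< (suc m) (λ α → ⟦ layer? α C′ ⟧) (s≤s (≤-trans (m/n≤m ∣ C′ ∣ ℓ) (∣p∣≤n C′))))
      where
      α = ∣ C′ ∣ / ℓ
      lower : α * ℓ ≤ ∣ C′ ∣
      lower = m/n*n≤m ∣ C′ ∣ ℓ
      upper : ∣ C′ ∣ ≤ ℓ + α * ℓ
      upper = ≤-trans (≤-reflexive (m≡m%n+[m/n]*n ∣ C′ ∣ ℓ)) (+-monoˡ-≤ (α * ℓ) (m%n≤n ∣ C′ ∣ ℓ))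

    rivals : ℕ
    rivals = ∑ (λ C′ → ⟦ rival? C′ ⟧ * weight D a (C ∪ C′))

    -- There are `suc m` layers of total weight at most `W / n ^ 2` each, and `2 * suc m ≤ n ^ 2`.
    2rivals≤W : 2 * rivals ≤ W
    2rivals≤W = *-cancelʳ-≤ _ _ (n ^ 2) {{m^n≢0 n 2}} (begin
      2 * rivals * n ^ 2                               ≡⟨ *-assoc 2 rivals (n ^ 2) ⟩
      2 * (rivals * n ^ 2)                             ≡⟨ cong (2 *_) (∑-*ʳ (n ^ 2) w) ⟨
      2 * ∑ (λ C′ → w C′ * n ^ 2)                      ≤⟨ *-monoʳ-≤ 2 (∑-mono term) ⟩
      2 * ∑ (λ C′ → ∑< (suc m) (λ α → wₗ C′ α * n ^ 2)) ≡⟨ cong (2 *_) (∑-∑< (suc m) (λ C′ α → wₗ C′ α * n ^ 2)) ⟩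
      2 * ∑< (suc m) (λ α → ∑ (λ C′ → wₗ C′ α * n ^ 2)) ≤⟨ *-monoʳ-≤ 2 (∑<-bound (suc m) (λ α → ∑ (λ C′ → wₗ C′ α * n ^ 2))
                                                            (λ α → ≤-trans (≤-reflexive (∑-*ʳ (n ^ 2) (λ C′ → wₗ C′ α))) (layer-sum α))) ⟩
      2 * (suc m * W)                                  ≡⟨ *-assoc 2 (suc m) W ⟨
      2 * suc m * W                                    ≤⟨ *-monoˡ-≤ W (*-mono-≤ (≤-trans (m≤m+n 2 m) 2+m≤n)
                                                            (≤-trans (≤-trans (n≤1+n (suc m)) 2+m≤n) (≤-reflexive (sym (*-identityʳ n))))) ⟩
      n ^ 2 * W                                        ≡⟨ *-comm (n ^ 2) W ⟩
      W * n ^ 2                                        ∎)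
      where
      open ≤-Reasoning
      w : Subset m → ℕ
      w C′ = ⟦ rival? C′ ⟧ * weight D a (C ∪ C′)
      wₗ : Subset m → ℕ → ℕ
      wₗ C′ α = ⟦ layer? α C′ ⟧ * weight D a (C ∪ C′)
      term : ∀ C′ → w C′ * n ^ 2 ≤ ∑< (suc m) (λ α → wₗ C′ α * n ^ 2)
      term C′ = begin
        ⟦ rival? C′ ⟧ * u * n ^ 2                               ≡⟨ *-assoc ⟦ rival? C′ ⟧ u (n ^ 2) ⟩
        ⟦ rival? C′ ⟧ * (u * n ^ 2)                             ≤⟨ *-monoˡ-≤ (u * n ^ 2) (rival-layers C′) ⟩
        ∑< (suc m) (λ α → ⟦ layer? α C′ ⟧) * (u * n ^ 2)        ≡⟨ ∑<-*ʳ (suc m) (u * n ^ 2) (λ α → ⟦ layer? α C′ ⟧) ⟨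
        ∑< (suc m) (λ α → ⟦ layer? α C′ ⟧ * (u * n ^ 2))        ≡⟨ ∑<-cong (suc m) (λ α → *-assoc ⟦ layer? α C′ ⟧ u (n ^ 2)) ⟨
        ∑< (suc m) (λ α → wₗ C′ α * n ^ 2)                      ∎
        where u = weight D a (C ∪ C′)

    -- The union bound at a single string: if `C` is sampled but not isolated, some rival is sampled
    -- along with it.
    contains-split : ∀ (x : Vec Bool (m * B)) → ⟦ C ⊆? sample a x ⟧ ≤ ⟦ isolatesAt? x ⟧ + ∑ (λ C′ → ⟦ rival? C′ ⟧ * ⟦ (C ∪ C′) ⊆? sample a x ⟧)
    contains-split x with C ⊆? sample a x | isolatesAt? x
    ... | no  _  | _      = z≤n
    ... | yes _  | yes _  = s≤s z≤n
    ... | yes C⊆ | no ¬iso with ¬isolated⇒circuit (λ e∈ → x∈p∩q⁺ (proj₁ cycC e∈ , C⊆ e∈)) (p∩q⊆p S (sample a x)) ¬iso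
    ...   | C′ , circ , C′≢C , C′⊆ = begin
      1                                                      ≡⟨ cong₂ _*_ (⟦yes⟧ (rival? C′) (circ , C′≢C)) (⟦yes⟧ ((C ∪ C′) ⊆? sample a x) C∪C′⊆) ⟨
      ⟦ rival? C′ ⟧ * ⟦ (C ∪ C′) ⊆? sample a x ⟧             ≤⟨ term≤∑ (λ C′ → ⟦ rival? C′ ⟧ * ⟦ (C ∪ C′) ⊆? sample a x ⟧) C′ ⟩
      ∑ (λ C′ → ⟦ rival? C′ ⟧ * ⟦ (C ∪ C′) ⊆? sample a x ⟧)  ∎
      where
      open ≤-Reasoning
      C∪C′⊆ : C ∪ C′ ⊆ sample a x
      C∪C′⊆ e∈ with x∈p∪q⁻ C C′ e∈
      ... | inj₁ e∈C  = C⊆ e∈C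
      ... | inj₂ e∈C′ = p∩q⊆q S (sample a x) (C′⊆ e∈C′)

    isolations : ℕ
    isolations = ∑ {m * B} (λ x → ⟦ isolatesAt? x ⟧)

    W≤isolations+rivals : W ≤ isolations + rivals
    W≤isolations+rivals = begin
      W
        ≡⟨ ∑-⊆sample C B a (num≤D p) ⟨
      ∑ (λ x → ⟦ C ⊆? sample a x ⟧)
        ≤⟨ ∑-mono contains-split ⟩
      ∑ (λ x → ⟦ isolatesAt? x ⟧ + ∑ (λ C′ → ⟦ rival? C′ ⟧ * ⟦ (C ∪ C′) ⊆? sample a x ⟧))
        ≡⟨ ∑-+ (λ x → ⟦ isolatesAt? x ⟧) (λ x → ∑ (λ C′ → ⟦ rival? C′ ⟧ * ⟦ (C ∪ C′) ⊆? sample a x ⟧)) ⟩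
      isolations + ∑ (λ x → ∑ (λ C′ → ⟦ rival? C′ ⟧ * ⟦ (C ∪ C′) ⊆? sample a x ⟧))
        ≡⟨ cong (isolations +_) (∑-swap (λ x C′ → ⟦ rival? C′ ⟧ * ⟦ (C ∪ C′) ⊆? sample a x ⟧)) ⟩
      isolations + ∑ (λ C′ → ∑ (λ x → ⟦ rival? C′ ⟧ * ⟦ (C ∪ C′) ⊆? sample a x ⟧))
        ≡⟨ cong (isolations +_) (∑-cong (λ C′ → trans (∑-*ˡ ⟦ rival? C′ ⟧ (λ x → ⟦ (C ∪ C′) ⊆? sample a x ⟧))
             (cong (⟦ rival? C′ ⟧ *_) (∑-⊆sample (C ∪ C′) B a (num≤D p))))) ⟩
      isolations + rivals ∎
      where open ≤-Reasoning

    -- Of the `W` strings that sample `C`, at most `rivals ≤ W / 2` fail to isolate it.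
    W≤2isolations : W ≤ 2 * isolations
    W≤2isolations = +-cancelʳ-≤ W W (2 * isolations) (begin
      W + W                               ≤⟨ +-mono-≤ W≤isolations+rivals W≤isolations+rivals ⟩
      g + rivals + (g + rivals)           ≡⟨ r g rivals ⟩
      2 * g + 2 * rivals                  ≤⟨ +-monoʳ-≤ (2 * g) 2rivals≤W ⟩
      2 * g + W                           ∎)
      where
      open ≤-Reasoning
      g = isolations
      r : ∀ g s → g + s + (g + s) ≡ 2 * g + 2 * s
      r = solve-∀

    -- As `∣ C ∣ ≤ 2 * ℓ`, the lower bound on `num` makes the probability of sampling all of `C` at
    -- least inverse polynomial.
    D^m≤W : D ^ m ≤ W * (n ^ suc (decay K)) ^ 2
    D^m≤W = *-cancelʳ-≤ _ _ (D ^ c) {{m^n≢0 D c}} (begin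
      D ^ m * D ^ c               ≤⟨ *-monoʳ-≤ (D ^ m) (power-lower {ℓ = ℓ} {{>-nonZero (num>0 p)}} (num≤D p) (num-lower p) c c≤2ℓ) ⟩
      D ^ m * (a ^ c * P)         ≡⟨ r (D ^ m) (a ^ c) P ⟩
      a ^ c * D ^ m * P           ≡⟨ cong (_* P) (weight-card D a C) ⟨
      W * D ^ c * P               ≡⟨ r′ W (D ^ c) P ⟩
      W * P * D ^ c               ∎)
      where
      open ≤-Reasoning
      c P : ℕ
      c = ∣ C ∣
      P = (n ^ suc (decay K)) ^ 2
      r : ∀ d a p → d * (a * p) ≡ a * d * p
      r = solve-∀
      r′ : ∀ w d p → w * d * p ≡ w * p * d
      r′ = solve-∀
      c≤2ℓ : c ≤ 2 * ℓ
      c≤2ℓ = *-cancelˡ-≤ 2 (≤-trans 2C≤3ℓ (≤-trans (*-monoˡ-≤ ℓ (n≤1+n 3)) (≤-reflexive (*-assoc 2 2 ℓ))))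

    D^m≤isolations : D ^ m ≤ isolations * (n * (n ^ suc (decay K)) ^ 2)
    D^m≤isolations = begin
      D ^ m                      ≤⟨ D^m≤W ⟩
      W * P                      ≤⟨ *-monoˡ-≤ P W≤2isolations ⟩
      2 * isolations * P         ≤⟨ *-monoˡ-≤ P (*-monoˡ-≤ isolations (≤-trans (m≤m+n 2 m) 2+m≤n)) ⟩
      n * isolations * P         ≡⟨ r n isolations P ⟩
      isolations * (n * P)       ∎
      where
      open ≤-Reasoning
      P = (n ^ suc (decay K)) ^ 2
      r : ∀ n g p → n * g * p ≡ g * (n * p)
      r = solve-∀

  -- Union bound over all sets and their short cycles

  Q N : ℕ
  Q = rarity K n
  N = sampleCount K m n

  -- The girth of `S` is unknown to the algorithm, so one random string is tried with the
  -- probability for each of the `m` possible girths.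
  Hit : Subset m → Subset m → Vec Bool (m * B) → Set
  Hit S C x = ∃ λ i → Isolates (S ∩ sample (num (prob i)) x) C

  hit? : ∀ S C x → Dec (Hit S C x)
  hit? S C x = any? (λ i → isolates? (S ∩ sample (num (prob i)) x) C)

  -- The girth of `S`, being positive, selects the index `i`; the hits at this one probability
  -- already suffice.
  short-hits : ∀ {S C} → Short S C → (2 ^ B) ^ m ≤ ∑ (λ x → ⟦ hit? S C x ⟧) * Q
  short-hits {S} {C} (cycC , short) with shortest-cycle cycC
  ... | C₀ , cyc₀@(_ , ne₀ , _) , girth with ∣ C₀ ∣ in len | nonempty⇒∣∣>0 ne₀
  ...   | suc ℓ-1 | _ = ≤-trans
          (D^m≤isolations cycC {{subst NonZero (sym ℓ≡) _}} minLength girth′ 2C≤3ℓ (prob i))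
          (*-monoˡ-≤ Q (∑-mono (λ x → ⟦⟧-mono (isolates? (S ∩ sample (num (prob i)) x) C) (hit? S C x) (i ,_))))
    where
    ℓ-1<m : ℓ-1 < m
    ℓ-1<m = subst (_≤ m) len (∣p∣≤n C₀)
    i : Fin m
    i = fromℕ< ℓ-1<m
    ℓ≡ : suc (toℕ i) ≡ suc ℓ-1
    ℓ≡ = cong suc (toℕ-fromℕ< ℓ-1<m)
    girth′ : ∀ {Z} → CycleIn S Z → suc (toℕ i) ≤ ∣ Z ∣
    girth′ cyc = ≤-trans (≤-reflexive ℓ≡) (girth cyc)
    minLength : MinCircuitLength M S (suc (toℕ i))
    minLength = (C₀ , (proj₁ cyc₀ , shortest⇒circuit cyc₀ (λ cyc → ≤-trans (≤-reflexive len) (girth cyc))) , trans len (sym ℓ≡)) ,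
                λ C′ circ → girth′ (circuit⇒cycle circ)
    2C≤3ℓ : 2 * ∣ C ∣ ≤ 3 * suc (toℕ i)
    2C≤3ℓ = ≤-trans (≮⇒≥ (λ lt → short (C₀ , cyc₀ , lt))) (≤-reflexive (cong (3 *_) (trans len (sym ℓ≡))))

  instance
    Q≢0 : NonZero Q
    Q≢0 = m*n≢0 n _ {{n≢0}} {{m^n≢0 (n ^ suc (decay K)) 2 {{m^n≢0 n (suc (decay K))}}}}

  miss : ∀ S C → Vec Bool (m * B) → ℕ
  miss S C x = ⟦ ¬? (hit? S C x) ⟧

  miss+hit : ∀ S C → ∑ (miss S C) + ∑ (λ x → ⟦ hit? S C x ⟧) ≡ (2 ^ B) ^ m
  miss+hit S C = begin
    ∑ (miss S C) + ∑ (λ x → ⟦ hit? S C x ⟧)     ≡⟨ ∑-+ (miss S C) (λ x → ⟦ hit? S C x ⟧) ⟨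
    ∑ (λ x → miss S C x + ⟦ hit? S C x ⟧)       ≡⟨ ∑-cong one ⟩
    ∑ {m * B} (λ _ → 1)                         ≡⟨ ∑-const (m * B) 1 ⟩
    2 ^ (m * B) * 1                             ≡⟨ *-identityʳ _ ⟩
    2 ^ (m * B)                                 ≡⟨ cong (2 ^_) (*-comm m B) ⟩
    2 ^ (B * m)                                 ≡⟨ ^-*-assoc 2 B m ⟨
    (2 ^ B) ^ m                                 ∎
    where
    open ≡-Reasoning
    one : ∀ x → miss S C x + ⟦ hit? S C x ⟧ ≡ 1
    one x with hit? S C x
    ... | yes _ = refl
    ... | no  _ = refl

  -- Hits make up at least a fraction `1 / Q` of the strings, so `amplification` applies with
  -- `N = Q * (3 * m)`.
  short-missed : ∀ S C → ⟦ short? S C ⟧ * (2 ^ (3 * m) * ∑ (miss S C) ^ N) ≤ ((2 ^ B) ^ m) ^ N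
  short-missed S C with short? S C
  ... | no  _     = z≤n
  ... | yes short = begin
    1 * (2 ^ (3 * m) * ∑ (miss S C) ^ N)     ≡⟨ *-identityˡ _ ⟩
    2 ^ (3 * m) * ∑ (miss S C) ^ N           ≤⟨ amplification (∑ (miss S C)) hits Q (3 * m) (≤-trans (≤-reflexive (miss+hit S C)) (short-hits short)) ⟩
    (∑ (miss S C) + hits) ^ N                ≡⟨ cong (_^ N) (miss+hit S C) ⟩
    ((2 ^ B) ^ m) ^ N                        ∎
    where
    open ≤-Reasoning
    hits = ∑ (λ x → ⟦ hit? S C x ⟧)

  -- The number of pairs `(S , C)`, with `C` short in `S`, that all `N` samples miss.
  failure : Vec Bool (N * (m * B)) → ℕ
  failure ρ = ∑ {m} (λ S → ∑ {m} (λ C → ⟦ short? S C ⟧ * ∏ {N} (λ j → miss S C (block j ρ))))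

  -- First moment: by independence of the blocks, each of the `4 ^ m` pairs is missed by at most a
  -- fraction `1 / 8 ^ m` of the strings.
  ∑-failure : 2 ^ (3 * m) * ∑ failure ≤ 2 ^ m * (2 ^ m * 2 ^ (N * (m * B)))
  ∑-failure = begin
    2 ^ (3 * m) * ∑ failure
      ≡⟨ cong (2 ^ (3 * m) *_) (trans (∑-swap (λ ρ S → ∑ (λ C → term S C ρ))) (∑-cong (λ S → ∑-swap (λ ρ C → term S C ρ)))) ⟩
    2 ^ (3 * m) * ∑ (λ S → ∑ (λ C → ∑ (term S C)))
      ≡⟨ ∑-*ˡ (2 ^ (3 * m)) (λ S → ∑ (λ C → ∑ (term S C))) ⟨
    ∑ (λ S → 2 ^ (3 * m) * ∑ (λ C → ∑ (term S C)))
      ≡⟨ ∑-cong (λ S → ∑-*ˡ (2 ^ (3 * m)) (λ C → ∑ (term S C))) ⟨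
    ∑ (λ S → ∑ (λ C → 2 ^ (3 * m) * ∑ (term S C)))
      ≤⟨ ∑-mono (λ S → ∑-mono (λ C → ≤-trans (≤-reflexive (pointwise S C)) (short-missed S C))) ⟩
    ∑ {m} (λ S → ∑ {m} (λ C → ((2 ^ B) ^ m) ^ N))
      ≡⟨ trans (∑-cong {m} (λ S → ∑-const m _)) (∑-const m _) ⟩
    2 ^ m * (2 ^ m * ((2 ^ B) ^ m) ^ N)
      ≡⟨ cong (λ e → 2 ^ m * (2 ^ m * e)) Ω ⟩
    2 ^ m * (2 ^ m * 2 ^ (N * (m * B))) ∎
    where
    open ≤-Reasoning
    term : ∀ S C → Vec Bool (N * (m * B)) → ℕ
    term S C ρ = ⟦ short? S C ⟧ * ∏ {N} (λ j → miss S C (block j ρ))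
    Ω : ((2 ^ B) ^ m) ^ N ≡ 2 ^ (N * (m * B))
    Ω = trans (cong (_^ N) (trans (^-*-assoc 2 B m) (cong (2 ^_) (*-comm B m))))
          (trans (^-*-assoc 2 (m * B) N) (cong (2 ^_) (*-comm (m * B) N)))
    r : ∀ p s x → p * (s * x) ≡ s * (p * x)
    r = solve-∀
    pointwise : ∀ S C → 2 ^ (3 * m) * ∑ (term S C) ≡ ⟦ short? S C ⟧ * (2 ^ (3 * m) * ∑ (miss S C) ^ N)
    pointwise S C = begin-equality
      2 ^ (3 * m) * ∑ (term S C)
        ≡⟨ cong (2 ^ (3 * m) *_) (∑-*ˡ ⟦ short? S C ⟧ (λ ρ → ∏ {N} (λ j → miss S C (block j ρ)))) ⟩
      2 ^ (3 * m) * (⟦ short? S C ⟧ * ∑ (λ ρ → ∏ {N} (λ j → miss S C (block j ρ))))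
        ≡⟨ cong (λ e → 2 ^ (3 * m) * (⟦ short? S C ⟧ * e)) (trans (∑-blocks N (λ _ → miss S C)) (∏-const N (∑ (miss S C)))) ⟩
      2 ^ (3 * m) * (⟦ short? S C ⟧ * ∑ (miss S C) ^ N)
        ≡⟨ r (2 ^ (3 * m)) ⟦ short? S C ⟧ _ ⟩
      ⟦ short? S C ⟧ * (2 ^ (3 * m) * ∑ (miss S C) ^ N) ∎

  failure≡0⇒hit : ∀ {ρ} → failure ρ ≡ 0 → ∀ S C → Short S C → ∃ λ (j : Fin N) → Hit S C (block j ρ)
  failure≡0⇒hit {ρ} none S C short with any? {n = N} (λ j → hit? S C (block j ρ))
  ... | yes hit = hit
  ... | no ¬hit = contradiction (≤-trans positive (≤-trans (term≤∑ (λ C → ⟦ short? S C ⟧ * ∏ {N} (λ j → miss S C (block j ρ))) C)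
                    (≤-trans (term≤∑ (λ S → ∑ (λ C → ⟦ short? S C ⟧ * ∏ {N} (λ j → miss S C (block j ρ)))) S) (≤-reflexive none)))) λ ()
    where
    positive : 1 ≤ ⟦ short? S C ⟧ * ∏ {N} (λ j → miss S C (block j ρ))
    positive = ≤-reflexive (sym (cong₂ _*_ (⟦yes⟧ (short? S C) short)
      (∏≡1 (λ j → miss S C (block j ρ)) (λ j → ⟦yes⟧ (¬? (hit? S C (block j ρ))) (λ h → ¬hit (j , h))))))

  -- Markov's inequality: `failure` is at least 1 at each listed string, its mean is at most
  -- `4 ^ m / 8 ^ m = 1 / 2 ^ m`, and `m ≤ 2 ^ m`.
  few-failures : ∀ (ρs : List (Vec Bool (N * (m * B)))) → Unique ρs → (∀ {ρ} → ρ ∈ˡ ρs → failure ρ ≢ 0) →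
                 length ρs * m ≤ 2 ^ (N * (m * B))
  few-failures ρs uniq fail = *-cancelʳ-≤ _ _ (2 ^ m * 2 ^ m) {{m*n≢0 _ _ {{m^n≢0 2 m}} {{m^n≢0 2 m}}}} (begin
    length ρs * m * (2 ^ m * 2 ^ m)                ≤⟨ *-monoˡ-≤ (2 ^ m * 2 ^ m) (*-mono-≤ (length≤∑ failure ρs uniq (λ ρ∈ → n≢0⇒n>0 (fail ρ∈))) (<⇒≤ (n<2^n m))) ⟩
    ∑ failure * 2 ^ m * (2 ^ m * 2 ^ m)            ≡⟨ r (∑ failure) (2 ^ m) ⟩
    2 ^ m * (2 ^ m * 2 ^ m) * ∑ failure            ≡⟨ cong (_* ∑ failure) cube ⟨
    2 ^ (3 * m) * ∑ failure                        ≤⟨ ∑-failure ⟩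
    2 ^ m * (2 ^ m * 2 ^ (N * (m * B)))            ≡⟨ r′ (2 ^ m) (2 ^ (N * (m * B))) ⟩
    2 ^ (N * (m * B)) * (2 ^ m * 2 ^ m)            ∎)
    where
    open ≤-Reasoning
    r : ∀ f p → f * p * (p * p) ≡ p * (p * p) * f
    r = solve-∀
    r′ : ∀ p x → p * (p * x) ≡ x * (p * p)
    r′ = solve-∀
    cube : 2 ^ (3 * m) ≡ 2 ^ m * (2 ^ m * 2 ^ m)
    cube = trans (cong (λ e → 2 ^ (m + (m + e))) (+-identityʳ m))
             (trans (^-distribˡ-+-* 2 m (m + m)) (cong (2 ^ m *_) (^-distribˡ-+-* 2 m m)))

-- Choice of parameters and complexity bounds

module Parameters (K : ℕ) where

  -- The number of queries is at most `3 * n ^ E`; `c` dominates both the exponent `E` and the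
  -- coefficient `3 * 2 ^ E` that arises from `n ≤ 2 * suc m`.
  A E c : ℕ
  A = decay K
  E = 4 + suc A * 2
  c = 3 * 2 ^ E + E

  -- The base `n` stands in for `m` because it must be at least 2 for every `m`; it is finally set
  -- to `2 + m`.
  module Size (m n : ℕ) (2+m≤n : 2 + m ≤ n) (n≤2*suc-m : n ≤ 2 * suc m) where

    B N J r : ℕ
    -- Gives `2 ^ B = (2 ^ n) ^ (2 + A) ≥ n ^ (2 + A)`, the resolution that `probability` asks for.
    B = n * (2 + A)
    N = sampleCount K m n
    J = m * N
    r = N * (m * B)

    m≤n : m ≤ n
    m≤n = ≤-trans (m≤n+m m 2) 2+m≤n

    prob : (i : Fin m) → Probability n A (2 ^ B) (suc (toℕ i))
    prob i = probability n A (2 ^ B) (suc (toℕ i)) {{_}} {{m*n≢0 8 (K + 2) {{_}} {{subst NonZero (+-comm 2 K) _}}}}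
      (≤-trans (m≤m+n 2 m) 2+m≤n) (≤-trans (toℕ<n i) m≤n)
      (≤-trans (^-monoˡ-≤ (2 + A) (<⇒≤ (n<2^n n))) (≤-reflexive (^-*-assoc 2 n (2 + A))))

    tests : Vec Bool r → Fin J → Subset m
    tests ρ j = uncurry (λ i s → sample (Probability.num (prob i)) (block s ρ)) (remQuot N j)

    tests-combine : ∀ ρ (i : Fin m) (s : Fin N) → tests ρ (combine i s) ≡ sample (Probability.num (prob i)) (block s ρ)
    tests-combine ρ i s = cong (uncurry (λ i s → sample (Probability.num (prob i)) (block s ρ))) (remQuot-combine i s)

    algorithm : RandAlg m (J * suc m) (2 * (⌊log₂ m ⌋ + 1)) r
    algorithm ρ = Algorithm.strategy (tests ρ) (2 * (⌊log₂ m ⌋ + 1)) ⊤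

    algorithm-correct : ∀ (M : Matroid m) → Binary M → SmoothCircuitBound M K → FindsBasisWHP algorithm M
    algorithm-correct M (d , v , rep) smooth ρs uniq fails =
      few-failures ρs uniq (λ {ρ} ρ∈ none → fails ρ∈ (Algorithm.Correctness.finds-basis (tests ρ) M v rep (covers none)))
      where
      open Cycles M v rep
      open Sampling M v rep K smooth n B 2+m≤n prob hiding (N)
      covers : ∀ {ρ} → failure ρ ≡ 0 → Algorithm.Correctness.Covers (tests ρ) M v rep
      covers {ρ} none S C short =
        let s , i , iso = failure≡0⇒hit none S C short in
        combine i s , subst (λ T → Isolates (S ∩ T) C) (sym (tests-combine ρ i s)) iso

    query-bound : J * suc m ≤ c * suc m ^ c
    query-bound = begin
      m * (n * P * (3 * m)) * suc m        ≤⟨ *-mono-≤ (*-mono-≤ m≤n (*-monoʳ-≤ (n * P) (*-monoʳ-≤ 3 m≤n))) (≤-trans (n≤1+n (suc m)) 2+m≤n) ⟩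
      n * (n * P * (3 * n)) * n            ≡⟨ ring n P ⟩
      3 * (n * (n * (n * (n * P))))        ≡⟨ cong (λ p → 3 * (n * (n * (n * (n * p))))) (^-*-assoc n (suc A) 2) ⟩
      3 * n ^ E                            ≤⟨ *-monoʳ-≤ 3 (^-monoˡ-≤ E n≤2*suc-m) ⟩
      3 * (2 * suc m) ^ E                  ≡⟨ cong (3 *_) (^-distribʳ-* 2 (suc m) E) ⟩
      3 * (2 ^ E * suc m ^ E)              ≡⟨ *-assoc 3 (2 ^ E) (suc m ^ E) ⟨
      3 * 2 ^ E * suc m ^ E                ≤⟨ *-mono-≤ (m≤m+n (3 * 2 ^ E) E) (^-monoʳ-≤ (suc m) (m≤n+m E (3 * 2 ^ E))) ⟩
      c * suc m ^ c                        ∎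
      where
      open ≤-Reasoning
      P : ℕ
      P = (n ^ suc A) ^ 2
      ring : ∀ n P → n * (n * P * (3 * n)) * n ≡ 3 * (n * (n * (n * (n * P))))
      ring = solve-∀

    round-bound : 2 * (⌊log₂ m ⌋ + 1) ≤ c * (⌊log₂ m ⌋ + 1)
    round-bound = *-monoˡ-≤ (⌊log₂ m ⌋ + 1) (≤-trans (n≤1+n 2)
      (≤-trans (m≤m*n 3 (2 ^ E) {{m^n≢0 2 E}}) (m≤m+n (3 * 2 ^ E) E)))

mainTheorem4 : ∀ (K : ℕ) → ∃ λ (c : ℕ) → ∀ (m : ℕ) →
    ∃ λ (q : ℕ) → ∃ λ (R : ℕ) → ∃ λ (r : ℕ) → Σ (RandAlg m q R r) λ A →
    R ≤ c * (⌊log₂ m ⌋ + 1) ×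
    q ≤ c * (suc m) ^ c ×
    (∀ (M : Matroid m) → Binary M → SmoothCircuitBound M K → FindsBasisWHP A M)
mainTheorem4 K = Parameters.c K , λ m → let open Parameters.Size K m (2 + m) ≤-refl (≤-trans (≤-reflexive (+-comm 1 (suc m))) (+-monoʳ-≤ (suc m) (s≤s z≤n))) in
  J * suc m , 2 * (⌊log₂ m ⌋ + 1) , r , algorithm , round-bound , query-bound , algorithm-correct
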